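{- Let $\mathbf{d}=(d_1,\ldots,d_n)$ be a graphic sequence with $d_1\ge d_2\ge\cdots\ge d_n$, and let $\delta\le n$ be a positive even integer. Then $\mathbf{d}\circ\delta=(d_1,\ldots,d_n,\delta)$ is graphic if and only if there is a realization $G$ of $\mathbf{d}$ on vertices $v_1,\ldots,v_n$ with $\deg_G(v_i)=d_i$ which has a matching of size $\delta/2$ covering the vertices $v_1,\ldots,v_\delta$ (the vertices with the $\delta$ largest degrees).
   Context: A finite sequence of nonnegative integers is graphic if there is a simple graph with a vertex labelling whose degree sequence is that sequence; such a graph is a realization. $\mathbf{d}\circ\delta$ denotes $\mathbf{d}$ with $\delta$ appended. A matching is a set of pairwise disjoint edges; it covers a vertex if some edge of it is incident to that vertex. -}

module Defs where

open import Data.Nat using (ℕ; _≤_; _<_; _/_; _%_)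
open import Data.Bool using (Bool; true; false; if_then_else_)
open import Data.Fin using (Fin; toℕ)
import Data.Fin as F
open import Data.Vec using (Vec; lookup; _∷ʳ_)
open import Data.List using (map; allFin)
open import Data.Nat.ListAction using (sum)
open import Data.Product using (Σ; _×_; _,_; ∃-syntax; proj₁; proj₂)
open import Data.Sum using (_⊎_)
open import Relation.Binary.PropositionalEquality using (_≡_; _≢_)

-- A simple graph on vertex set Fin n (vertex i is v_(i+1)):
-- a symmetric, irreflexive Boolean adjacency relation.
record Graph (n : ℕ) : Set where
  field
    adj   : Fin n → Fin n → Bool
    sym   : ∀ i j → adj i j ≡ adj j i
    irrefl : ∀ i → adj i i ≡ false
open Graph public

deg : ∀ {n} → Graph n → Fin n → ℕ
deg {n} G i = sum (map (λ j → if adj G i j then 1 else 0) (allFin n))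

Realizes : ∀ {n} → Graph n → Vec ℕ n → Set
Realizes G d = ∀ i → deg G i ≡ lookup d i

Graphic : ∀ {n} → Vec ℕ n → Set
Graphic {n} d = Σ (Graph n) λ G → Realizes G d

NonIncreasing : ∀ {n} → Vec ℕ n → Set
NonIncreasing d = ∀ i j → i F.≤ j → lookup d j ≤ lookup d i

Edge : ∀ {n} → Graph n → Fin n × Fin n → Set
Edge G (a , b) = adj G a b ≡ true

DisjointPair : ∀ {n} → Fin n × Fin n → Fin n × Fin n → Set
DisjointPair (a , b) (c , e) = a ≢ c × a ≢ e × b ≢ c × b ≢ e

record Matching {n : ℕ} (G : Graph n) (k : ℕ) : Set where
  field
    edge     : Fin k → Fin n × Fin n
    isEdge   : ∀ p → Edge G (edge p)
    disjoint : ∀ p q → p ≢ q → DisjointPair (edge p) (edge q)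
open Matching public

Covers : ∀ {n} {G : Graph n} {k} → Matching G k → Fin n → Set
Covers M v = ∃[ p ] (proj₁ (edge M p) ≡ v ⊎ proj₂ (edge M p) ≡ v)

-- Backwards: each edge ab of the matching is traded for the edges ua and ub at a new vertex u, which then
-- has degree δ while all other degrees are unchanged.
-- Forwards: take a realization G of d, extended by an isolated vertex u, and a realization H of d ∘ δ.
-- Two-switches in G or in H that shrink their symmetric difference eventually put every edge of H away
-- from u into G; as the degrees off u agree, the edges of G outside H then form a matching covering
-- exactly the δ neighbours of u in H. While some vertex x among v₁ … v_δ is uncovered, a covered vertex y
-- outside them exists, matched to z say; since deg x ≥ deg y, either xz is already an edge of G or a
-- switch xw, zy ↦ xz, wy makes it one, and replacing yz by xz in the matching covers x.

module Submission where

open import Defs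
open import Data.Nat using (ℕ; _≤_; _<_; _/_; _%_)
open import Data.Fin using (toℕ)
open import Data.Vec using (Vec; _∷ʳ_)
open import Data.Product using (Σ; _×_)
open import Function.Bundles using (_⇔_)
open import Relation.Binary.PropositionalEquality using (_≡_)

open import Data.Nat using (zero; suc; _+_; _*_; _∸_; z≤n; s≤s; z<s; _<ᵇ_; _<?_)
open import Data.Nat.DivMod using (m/n*n≡m)
open import Data.Nat.Divisibility using (m%n≡0⇒n∣m)
open import Data.Nat.Properties hiding (_≟_; suc-injective)
open import Data.Nat.Properties using () renaming (_≟_ to _≟ℕ_)
open import Data.Nat.Induction using (<-wellFounded)
open import Induction.WellFounded using (Acc; acc)
open import Data.Nat.Tactic.RingSolver using (solve-∀)
open import Algebra.Properties.CommutativeMonoid.Sum +-0-commutativeMonoid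
  using (sum; sum-cong-≗; sum-remove; ∑-distrib-+; sum-replicate-zero; sum-init-last)
open import Data.Bool using (Bool; true; false; if_then_else_; not; _∧_; _∨_; _xor_; T)
open import Data.Bool.Properties using (∨-comm; ∧-comm; ∧-zeroʳ; ¬-not; xor-comm) renaming (_≟_ to _≟ᵇ_)
open import Data.Fin using (Fin; zero; suc; punchIn; inject₁; fromℕ)
open import Data.Fin.Relation.Unary.Top using (view; ‵fromℕ; ‵inject₁; view-inject₁; view-fromℕ) renaming (View to TopView)
open import Data.Fin.Properties
  using (_≟_; punchInᵢ≢i; ¬∀⟶∃¬; any?; suc-injective; inject₁-injective; fromℕ≢inject₁; toℕ-inject₁; toℕ-fromℕ)
open import Data.Vec.Functional using (updateAt)
open import Data.Vec.Functional.Properties using (updateAt-updates; updateAt-minimal)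
open import Data.List using (map; tabulate)
open import Data.Vec using ([]; _∷_; lookup)
import Data.Nat.ListAction as List
open import Data.Product using (_,_; ∃-syntax; proj₁; proj₂)
open import Data.Sum using (_⊎_; inj₁; inj₂; [_,_]′)
open import Data.Empty using (⊥)
open import Function using (_∘_; const; id)
open import Function.Bundles using (mk⇔)
open import Relation.Nullary using (¬_; Dec; yes; no; does; ¬?; _×-dec_; contradiction)
open import Relation.Nullary.Decidable using (dec-true; dec-false)
open import Relation.Binary.PropositionalEquality hiding (sym; _≡_)
import Relation.Binary.PropositionalEquality as ≡

-- Indicator sums

χ : Bool → ℕ
χ b = if b then 1 else 0

χ≤1 : ∀ b → χ b ≤ 1
χ≤1 true  = ≤-refl
χ≤1 false = z≤n

χ-< : ∀ {p q} → χ p < χ q → p ≡ false × q ≡ true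
χ-< {false} {true} _ = refl , refl
χ-< {true}  {true} (s≤s ())
χ-< {_}     {false} ()

χ-≟-refl : ∀ {N} (p : Fin N) → χ (does (p ≟ p)) ≡ 1
χ-≟-refl p = cong χ (dec-true (p ≟ p) refl)

χ-≟-≢ : ∀ {N} {j p : Fin N} → j ≢ p → χ (does (j ≟ p)) ≡ 0
χ-≟-≢ {j = j} {p} j≢p = cong χ (dec-false (j ≟ p) j≢p)

+-swapʳ : ∀ a b c → a + b + c ≡ a + c + b
+-swapʳ = solve-∀

sum-mono-≤ : ∀ {N} {f g : Fin N → ℕ} → (∀ j → f j ≤ g j) → sum f ≤ sum g
sum-mono-≤ {zero}  le = z≤n
sum-mono-≤ {suc N} le = +-mono-≤ (le zero) (sum-mono-≤ (le ∘ suc))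

sum-mono-< : ∀ {N} {f g : Fin N → ℕ} p → (∀ j → f j ≤ g j) → f p < g p → sum f < sum g
sum-mono-< zero    le lt = +-mono-<-≤ lt (sum-mono-≤ (le ∘ suc))
sum-mono-< (suc p) le lt = +-mono-≤-< (le zero) (sum-mono-< p (le ∘ suc) lt)

sum-witness : ∀ {N} (f g : Fin N → ℕ) → sum g < sum f → ∃[ j ] g j < f j
sum-witness {N} f g lt with ¬∀⟶∃¬ N (λ j → f j ≤ g j) (λ j → f j ≤? g j) (λ le → <⇒≱ lt (sum-mono-≤ le))
... | j , f≰g = j , ≰⇒> f≰g

≤-sum : ∀ {N} (f : Fin N → ℕ) p → f p ≤ sum f
≤-sum f zero    = m≤m+n _ _
≤-sum f (suc p) = ≤-trans (≤-sum (f ∘ suc) p) (m≤n+m _ _)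

sum-update-≤ : ∀ {N} (f g : Fin N → ℕ) p → (∀ j → j ≢ p → f j ≤ g j) → sum f + g p ≤ sum g + f p
sum-update-≤ {suc _} f g p le = begin
  sum f + g p                     ≡⟨ cong (_+ g p) (sum-remove {i = p} f) ⟩
  f p + sum (f ∘ punchIn p) + g p ≤⟨ +-monoˡ-≤ (g p) (+-monoʳ-≤ (f p) (sum-mono-≤ (λ j → le _ (punchInᵢ≢i p j)))) ⟩
  f p + sum (g ∘ punchIn p) + g p ≡⟨ rearrange (f p) (sum (g ∘ punchIn p)) (g p) ⟩
  g p + sum (g ∘ punchIn p) + f p ≡⟨ cong (_+ f p) (sum-remove {i = p} g) ⟨
  sum g + f p                     ∎
  where
  open ≤-Reasoning
  rearrange : ∀ a s b → a + s + b ≡ b + s + a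
  rearrange = solve-∀

sum-update : ∀ {N} (f g : Fin N → ℕ) p → (∀ j → j ≢ p → f j ≡ g j) → sum f + g p ≡ sum g + f p
sum-update f g p eq = ≤-antisym (sum-update-≤ f g p (λ j j≢p → ≤-reflexive (eq j j≢p)))
                                (sum-update-≤ g f p (λ j j≢p → ≤-reflexive (≡.sym (eq j j≢p))))

sum-update₂-≤ : ∀ {N} (f g : Fin N → ℕ) p q → p ≢ q → (∀ j → j ≢ p → j ≢ q → f j ≤ g j) →
  sum f + g p + g q ≤ sum g + f p + f q
sum-update₂-≤ f g p q p≢q le = begin
  sum f + g p + g q ≡⟨ cong (λ x → sum f + x + g q) (updateAt-updates p f) ⟨
  sum f + k p + g q ≤⟨ +-monoˡ-≤ (g q) (sum-update-≤ f k p (λ j j≢p → ≤-reflexive (≡.sym (updateAt-minimal j p f j≢p)))) ⟩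
  sum k + f p + g q ≡⟨ +-swapʳ (sum k) (f p) (g q) ⟩
  sum k + g q + f p ≤⟨ +-monoˡ-≤ (f p) (sum-update-≤ k g q k≤g) ⟩
  sum g + k q + f p ≡⟨ cong (λ x → sum g + x + f p) (updateAt-minimal q p f (p≢q ∘ ≡.sym)) ⟩
  sum g + f q + f p ≡⟨ +-swapʳ (sum g) (f q) (f p) ⟩
  sum g + f p + f q ∎
  where
  open ≤-Reasoning
  k = updateAt f p (const (g p))
  k≤g : ∀ j → j ≢ q → k j ≤ g j
  k≤g j j≢q with j ≟ p
  ... | yes refl = ≤-reflexive (updateAt-updates p f)
  ... | no j≢p   = subst (_≤ g j) (≡.sym (updateAt-minimal j p f j≢p)) (le j j≢p j≢q)

sum-mono-≤-at₂ : ∀ {N} (f g : Fin N → ℕ) p q → p ≢ q → (∀ j → j ≢ p → j ≢ q → f j ≤ g j) →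
  f p + f q ≤ g p + g q → sum f ≤ sum g
sum-mono-≤-at₂ f g p q p≢q le le-pq = +-cancelʳ-≤ (g p + g q) (sum f) (sum g) (begin
  sum f + (g p + g q) ≡⟨ +-assoc (sum f) (g p) (g q) ⟨
  sum f + g p + g q   ≤⟨ sum-update₂-≤ f g p q p≢q le ⟩
  sum g + f p + f q   ≡⟨ +-assoc (sum g) (f p) (f q) ⟩
  sum g + (f p + f q) ≤⟨ +-monoʳ-≤ (sum g) le-pq ⟩
  sum g + (g p + g q) ∎)
  where open ≤-Reasoning

sum-mono-<-at₂ : ∀ {N} (f g : Fin N → ℕ) p q → p ≢ q → (∀ j → j ≢ p → j ≢ q → f j ≤ g j) →
  f p + f q < g p + g q → sum f < sum g
sum-mono-<-at₂ f g p q p≢q le lt-pq = +-cancelʳ-< (g p + g q) (sum f) (sum g) (begin-strict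
  sum f + (g p + g q) ≡⟨ +-assoc (sum f) (g p) (g q) ⟨
  sum f + g p + g q   ≤⟨ sum-update₂-≤ f g p q p≢q le ⟩
  sum g + f p + f q   ≡⟨ +-assoc (sum g) (f p) (f q) ⟩
  sum g + (f p + f q) <⟨ +-monoʳ-< (sum g) lt-pq ⟩
  sum g + (g p + g q) ∎)
  where open ≤-Reasoning

sum-swap : ∀ {N} (f g : Fin N → ℕ) p q → p ≢ q → (∀ j → j ≢ p → j ≢ q → f j ≡ g j) →
  f p ≡ g q → f q ≡ g p → sum f ≡ sum g
sum-swap f g p q p≢q eq fp≡gq fq≡gp =
  ≤-antisym (sum-mono-≤-at₂ f g p q p≢q (λ j j≢p j≢q → ≤-reflexive (eq j j≢p j≢q)) (≤-reflexive f≡g-at))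
            (sum-mono-≤-at₂ g f p q p≢q (λ j j≢p j≢q → ≤-reflexive (≡.sym (eq j j≢p j≢q)))
                            (≤-reflexive (≡.sym f≡g-at)))
  where
  f≡g-at : f p + f q ≡ g p + g q
  f≡g-at = trans (cong₂ _+_ fp≡gq fq≡gp) (+-comm (g q) (g p))

sum-update₃-≤ : ∀ {N} (f g : Fin N → ℕ) p q r → p ≢ q → p ≢ r → q ≢ r →
  (∀ j → j ≢ p → j ≢ q → j ≢ r → f j ≤ g j) →
  sum f + (g p + g q + g r) ≤ sum g + (f p + f q + f r)
sum-update₃-≤ f g p q r p≢q p≢r q≢r le = begin
  sum f + (g p + g q + g r) ≡⟨ cong (λ x → sum f + (x + g q + g r)) (updateAt-updates p f) ⟨
  sum f + (k p + g q + g r) ≡⟨ shuffle (sum f) (k p) (g q) (g r) ⟩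
  sum f + k p + g q + g r   ≤⟨ +-monoˡ-≤ (g r) (+-monoˡ-≤ (g q) (sum-update-≤ f k p f≤k)) ⟩
  sum k + f p + g q + g r   ≡⟨ shuffle′ (sum k) (f p) (g q) (g r) ⟩
  sum k + g q + g r + f p   ≤⟨ +-monoˡ-≤ (f p) (sum-update₂-≤ k g q r q≢r k≤g) ⟩
  sum g + k q + k r + f p   ≡⟨ cong₂ (λ x y → sum g + x + y + f p) (updateAt-minimal q p f (p≢q ∘ ≡.sym))
                                                                  (updateAt-minimal r p f (p≢r ∘ ≡.sym)) ⟩
  sum g + f q + f r + f p   ≡⟨ shuffle″ (sum g) (f p) (f q) (f r) ⟩
  sum g + (f p + f q + f r) ∎
  where
  open ≤-Reasoning
  k = updateAt f p (const (g p))
  f≤k : ∀ j → j ≢ p → f j ≤ k j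
  f≤k j j≢p = ≤-reflexive (≡.sym (updateAt-minimal j p f j≢p))
  k≤g : ∀ j → j ≢ q → j ≢ r → k j ≤ g j
  k≤g j j≢q j≢r with j ≟ p
  ... | yes refl = ≤-reflexive (updateAt-updates p f)
  ... | no j≢p   = subst (_≤ g j) (≡.sym (updateAt-minimal j p f j≢p)) (le j j≢p j≢q j≢r)
  shuffle : ∀ s a b c → s + (a + b + c) ≡ s + a + b + c
  shuffle = solve-∀
  shuffle′ : ∀ s a b c → s + a + b + c ≡ s + b + c + a
  shuffle′ = solve-∀
  shuffle″ : ∀ s a b c → s + b + c + a ≡ s + (a + b + c)
  shuffle″ = solve-∀

sum-witness-outside₃ : ∀ {N} (f g : Fin N → ℕ) a b c → a ≢ b → a ≢ c → b ≢ c → sum g ≤ sum f →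
  f a + f b + f c < g a + g b + g c → ∃[ w ] (w ≢ a × w ≢ b × w ≢ c × g w < f w)
sum-witness-outside₃ f g a b c a≢b a≢c b≢c ∑g≤∑f lt
  with any? (λ w → ¬? (w ≟ a) ×-dec ¬? (w ≟ b) ×-dec ¬? (w ≟ c) ×-dec g w <? f w)
... | yes found = found
... | no none = contradiction (sum-update₃-≤ f g a b c a≢b a≢c b≢c f≤g)
                              (<⇒≱ (+-mono-≤-< ∑g≤∑f lt))
  where
  f≤g : ∀ w → w ≢ a → w ≢ b → w ≢ c → f w ≤ g w
  f≤g w w≢a w≢b w≢c = ≮⇒≥ (λ gw<fw → none (w , w≢a , w≢b , w≢c , gw<fw))

sum-supported : ∀ {N} (f : Fin N → ℕ) p → (∀ j → j ≢ p → f j ≡ 0) → sum f ≡ f p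
sum-supported {N} f p zero-off = begin
  sum f                         ≡⟨ +-identityʳ (sum f) ⟨
  sum f + 0                     ≡⟨ sum-update f (λ _ → 0) p zero-off ⟩
  sum (λ (_ : Fin N) → 0) + f p ≡⟨ cong (_+ f p) (sum-replicate-zero N) ⟩
  f p                           ∎
  where open ≡-Reasoning

sum-indicator : ∀ {N} (p : Fin N) → sum (λ j → χ (does (j ≟ p))) ≡ 1
sum-indicator p = begin
  sum (λ j → χ (does (j ≟ p))) ≡⟨ sum-supported _ p (λ j → χ-≟-≢) ⟩
  χ (does (p ≟ p))             ≡⟨ χ-≟-refl p ⟩
  1                       ∎
  where open ≡-Reasoning

<⇒<ᵇ≡true : ∀ {m n} → m < n → (m <ᵇ n) ≡ true
<⇒<ᵇ≡true m<n = T⇒≡true (<⇒<ᵇ m<n)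
  where
  T⇒≡true : ∀ {b} → T b → b ≡ true
  T⇒≡true {true} _ = refl

<ᵇ≡false⇒≥ : ∀ {m n} → (m <ᵇ n) ≡ false → n ≤ m
<ᵇ≡false⇒≥ m≮n = ≮⇒≥ λ m<n → contradiction (trans (≡.sym (<⇒<ᵇ≡true m<n)) m≮n) λ ()

≤⇒<ᵇ≡false : ∀ {m n} → n ≤ m → (m <ᵇ n) ≡ false
≤⇒<ᵇ≡false {m} {n} n≤m = ¬-not λ m<ᵇn → <⇒≱ (<ᵇ⇒< m n (subst T (≡.sym m<ᵇn) _)) n≤m

sum-initial-segment : ∀ N k → k ≤ N → sum (λ (v : Fin N) → χ (toℕ v <ᵇ k)) ≡ k
sum-initial-segment N       zero    _         = sum-replicate-zero N
sum-initial-segment (suc N) (suc k) (s≤s k≤N) = cong suc (sum-initial-segment N k k≤N)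

descend : ∀ {A : Set} {Done : A → Set} (μ : A → ℕ) → (∀ a → Done a ⊎ Σ A (λ b → μ b < μ a)) → A → Σ A Done
descend {A} {Done} μ step a = go a (<-wellFounded (μ a))
  where
  go : ∀ a → Acc _<_ (μ a) → Σ A Done
  go a (acc smaller) with step a
  ... | inj₁ done       = a , done
  ... | inj₂ (b , μb<μa) = go b (smaller μb<μa)

-- Adjacency relations and edge updates

Adj : ℕ → Set
Adj N = Fin N → Fin N → Bool

Symmetric : ∀ {N} → Adj N → Set
Symmetric R = ∀ i j → R i j ≡ R j i

degree : ∀ {N} → Adj N → Fin N → ℕ
degree R i = sum (λ j → χ (R i j))

size : ∀ {N} → Adj N → ℕ
size R = sum (degree R)

sumₗ-map-tabulate : ∀ {A : Set} N (f : Fin N → A) (g : A → ℕ) →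
  List.sum (map g (tabulate f)) ≡ sum (g ∘ f)
sumₗ-map-tabulate zero    f g = refl
sumₗ-map-tabulate (suc N) f g = cong (g (f zero) +_) (sumₗ-map-tabulate N (f ∘ suc) g)

deg≡degree : ∀ {N} (G : Graph N) i → deg G i ≡ degree (adj G) i
deg≡degree {N} G i = sumₗ-map-tabulate N id (λ j → χ (adj G i j))

adj⇒≢ : ∀ {N} (G : Graph N) {i j} → adj G i j ≡ true → i ≢ j
adj⇒≢ G {i} ij refl = contradiction (trans (≡.sym ij) (Graph.irrefl G i)) λ ()

Isolated : ∀ {N} → Graph N → Fin N → Set
Isolated G u = ∀ j → adj G u j ≡ false

Isolated-≢ : ∀ {N} (G : Graph N) {u} → Isolated G u → ∀ {i j} → adj G i j ≡ true → j ≢ u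
Isolated-≢ G isolated {i} ij refl = contradiction (trans (≡.sym ij) (trans (Graph.sym G i _) (isolated i))) λ ()

degree-zero : ∀ {N} (R : Adj N) v → degree R v ≡ 0 → ∀ j → R v j ≡ false
degree-zero R v deg≡0 j = ¬-not λ vj → contradiction (begin
  1          ≡⟨ cong χ vj ⟨
  χ (R v j)  ≤⟨ ≤-sum (λ j → χ (R v j)) j ⟩
  degree R v ≡⟨ deg≡0 ⟩
  0          ∎) λ ()
  where open ≤-Reasoning

degree-pos : ∀ {N} (R : Adj N) v → 0 < degree R v → ∃[ j ] R v j ≡ true
degree-pos {N} R v pos with sum-witness (λ j → χ (R v j)) (λ _ → 0) (subst (_< degree R v) (≡.sym (sum-replicate-zero N)) pos)
... | j , lt = j , proj₂ (χ-< lt)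

_∖_ : ∀ {N} → Adj N → Adj N → Adj N
(R ∖ S) i j = not (S i j) ∧ R i j

_∖ᴳ_ : ∀ {N} → Graph N → Graph N → Graph N
G ∖ᴳ H = record
  { adj    = adj G ∖ adj H
  ; sym    = λ i j → cong₂ (λ h g → not h ∧ g) (Graph.sym H i j) (Graph.sym G i j)
  ; irrefl = λ i → trans (cong (not (adj H i i) ∧_) (Graph.irrefl G i)) (∧-zeroʳ _)
  }

_△_ : ∀ {N} → Adj N → Adj N → Adj N
(R △ S) i j = R i j xor S i j

size-△-comm : ∀ {N} (R S : Adj N) → size (R △ S) ≡ size (S △ R)
size-△-comm R S = sum-cong-≗ (λ i → sum-cong-≗ (λ j → cong χ (xor-comm (R i j) (S i j))))

joins : ∀ {N} → Fin N → Fin N → Fin N → Fin N → Bool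
joins a b i j = (does (i ≟ a) ∧ does (j ≟ b)) ∨ (does (i ≟ b) ∧ does (j ≟ a))

joins-sym : ∀ {N} (a b i j : Fin N) → joins a b i j ≡ joins a b j i
joins-sym a b i j = trans (∨-comm (does (i ≟ a) ∧ does (j ≟ b)) _)
                          (cong₂ _∨_ (∧-comm (does (i ≟ b)) _) (∧-comm (does (i ≟ a)) _))

joins-comm : ∀ {N} (a b i j : Fin N) → joins a b i j ≡ joins b a i j
joins-comm a b i j = ∨-comm (does (i ≟ a) ∧ does (j ≟ b)) _

module _ {N : ℕ} {a b i j : Fin N} where

  joins-true : joins a b i j ≡ true → (i ≡ a × j ≡ b) ⊎ (i ≡ b × j ≡ a)
  joins-true e with i ≟ a | j ≟ b | i ≟ b | j ≟ a
  ... | yes i≡a | yes j≡b | _       | _       = inj₁ (i≡a , j≡b)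
  ... | _       | _       | yes i≡b | yes j≡a = inj₂ (i≡b , j≡a)
  joins-true () | no _  | _     | no _  | _
  joins-true () | no _  | _     | yes _ | no _
  joins-true () | yes _ | no _  | no _  | _
  joins-true () | yes _ | no _  | yes _ | no _

  joins-false : ¬ ((i ≡ a × j ≡ b) ⊎ (i ≡ b × j ≡ a)) → joins a b i j ≡ false
  joins-false ¬ends = ¬-not (¬ends ∘ joins-true)

joins-miss-row : ∀ {N} {a b i : Fin N} j → i ≢ a → i ≢ b → joins a b i j ≡ false
joins-miss-row j i≢a i≢b = joins-false {j = j} λ { (inj₁ (i≡a , _)) → i≢a i≡a ; (inj₂ (i≡b , _)) → i≢b i≡b }

joins-miss-fst : ∀ {N} {a i j : Fin N} b → i ≢ a → j ≢ a → joins a b i j ≡ false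
joins-miss-fst b i≢a j≢a = joins-false {b = b} λ { (inj₁ (i≡a , _)) → i≢a i≡a ; (inj₂ (_ , j≡a)) → j≢a j≡a }

joins-miss-snd : ∀ {N} {b i j : Fin N} a → i ≢ b → j ≢ b → joins a b i j ≡ false
joins-miss-snd a i≢b j≢b = joins-false {a = a} λ { (inj₁ (_ , j≡b)) → j≢b j≡b ; (inj₂ (i≡b , _)) → i≢b i≡b }

joins-ends : ∀ {N} (a b : Fin N) → joins a b a b ≡ true
joins-ends a b rewrite dec-true (a ≟ a) refl | dec-true (b ≟ b) refl = refl

joins-irrefl : ∀ {N} {a b : Fin N} i → a ≢ b → joins a b i i ≡ false
joins-irrefl {a = a} {b} i a≢b =
  joins-false {a = a} {b} {i} {i} λ { (inj₁ (refl , refl)) → a≢b refl ; (inj₂ (refl , refl)) → a≢b refl }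

setEdge : ∀ {N} → Adj N → Fin N → Fin N → Bool → Adj N
setEdge R a b β i j = if joins a b i j then β else R i j

module _ {N : ℕ} (R : Adj N) (a b : Fin N) (β : Bool) where

  setEdge-on : ∀ i j → joins a b i j ≡ true → setEdge R a b β i j ≡ β
  setEdge-on i j e rewrite e = refl

  setEdge-off : ∀ i j → joins a b i j ≡ false → setEdge R a b β i j ≡ R i j
  setEdge-off i j e rewrite e = refl

  setEdge-comm : ∀ i j → setEdge R a b β i j ≡ setEdge R b a β i j
  setEdge-comm i j = cong (if_then β else R i j) (joins-comm a b i j)

  degree-setEdge-fst : a ≢ b → degree (setEdge R a b β) a + χ (R a b) ≡ degree R a + χ β
  degree-setEdge-fst a≢b = begin
    degree (setEdge R a b β) a + χ (R a b)
      ≡⟨ sum-update _ _ b (λ j j≢b → cong χ (setEdge-off a j (joins-miss-snd a a≢b j≢b))) ⟩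
    degree R a + χ (setEdge R a b β a b)                ≡⟨ cong (λ x → degree R a + χ x) (setEdge-on a b (joins-ends a b)) ⟩
    degree R a + χ β                                    ∎
    where open ≡-Reasoning

  degree-setEdge-other : ∀ v → v ≢ a → v ≢ b → degree (setEdge R a b β) v ≡ degree R v
  degree-setEdge-other v v≢a v≢b = sum-cong-≗ (λ j → cong χ (setEdge-off v j (joins-miss-row j v≢a v≢b)))

degree-setEdge-snd : ∀ {N} (R : Adj N) a b β → a ≢ b → degree (setEdge R a b β) b + χ (R b a) ≡ degree R b + χ β
degree-setEdge-snd R a b β a≢b =
  trans (cong (_+ χ (R b a)) (sum-cong-≗ (λ j → cong χ (setEdge-comm R a b β b j))))
        (degree-setEdge-fst R b a β (a≢b ∘ ≡.sym))

setEdgeᴳ : ∀ {N} (G : Graph N) (a b : Fin N) → a ≢ b → Bool → Graph N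
setEdgeᴳ G a b a≢b β = record
  { adj    = setEdge (adj G) a b β
  ; sym    = λ i j → cong₂ (if_then β else_) (joins-sym a b i j) (Graph.sym G i j)
  ; irrefl = λ i → trans (setEdge-off (adj G) a b β i i (joins-irrefl i a≢b)) (Graph.irrefl G i)
  }

setEdge-false-⊆ : ∀ {N} (R : Adj N) a b i j → setEdge R a b false i j ≡ true → R i j ≡ true
setEdge-false-⊆ R a b i j e with joins a b i j
... | true  = contradiction e λ ()
... | false = e

degree-remove : ∀ {N} (R : Adj N) {a b} → Symmetric R → a ≢ b → R a b ≡ true →
  ∀ v → degree (setEdge R a b false) v + χ (does (v ≟ a)) + χ (does (v ≟ b)) ≡ degree R v
degree-remove R {a} {b} R-sym a≢b ab v = by-cases (v ≟ a) (v ≟ b)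
  where
  open ≡-Reasoning
  R′ = setEdge R a b false
  by-cases : Dec (v ≡ a) → Dec (v ≡ b) → degree R′ v + χ (does (v ≟ a)) + χ (does (v ≟ b)) ≡ degree R v
  by-cases (yes refl) _ = begin
    degree R′ a + χ (does (a ≟ a)) + χ (does (a ≟ b)) ≡⟨ cong₂ (λ s t → degree R′ a + s + t) (χ-≟-refl a) (χ-≟-≢ a≢b) ⟩
    degree R′ a + 1 + 0                               ≡⟨ +-identityʳ _ ⟩
    degree R′ a + 1                                   ≡⟨ cong (λ t → degree R′ a + χ t) ab ⟨
    degree R′ a + χ (R a b)                           ≡⟨ degree-setEdge-fst R a b false a≢b ⟩
    degree R a + 0                                    ≡⟨ +-identityʳ _ ⟩
    degree R a                                        ∎
  by-cases (no v≢a) (yes refl) = begin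
    degree R′ b + χ (does (b ≟ a)) + χ (does (b ≟ b)) ≡⟨ cong₂ (λ s t → degree R′ b + s + t) (χ-≟-≢ v≢a) (χ-≟-refl b) ⟩
    degree R′ b + 0 + 1                               ≡⟨ cong (_+ 1) (+-identityʳ _) ⟩
    degree R′ b + 1                                   ≡⟨ cong (λ t → degree R′ b + χ t) (trans (R-sym b a) ab) ⟨
    degree R′ b + χ (R b a)                           ≡⟨ degree-setEdge-snd R a b false a≢b ⟩
    degree R b + 0                                    ≡⟨ +-identityʳ _ ⟩
    degree R b                                        ∎
  by-cases (no v≢a) (no v≢b) = begin
    degree R′ v + χ (does (v ≟ a)) + χ (does (v ≟ b)) ≡⟨ cong₂ (λ s t → degree R′ v + s + t) (χ-≟-≢ v≢a) (χ-≟-≢ v≢b) ⟩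
    degree R′ v + 0 + 0                               ≡⟨ trans (+-identityʳ _) (+-identityʳ _) ⟩
    degree R′ v                                       ≡⟨ degree-setEdge-other R a b false v v≢a v≢b ⟩
    degree R v                                        ∎

size-remove : ∀ {N} (R : Adj N) {a b} → Symmetric R → a ≢ b → R a b ≡ true →
  size (setEdge R a b false) + 2 ≡ size R
size-remove {N} R {a} {b} R-sym a≢b ab = begin
  size R′ + 2                                            ≡⟨ +-assoc _ 1 1 ⟨
  size R′ + 1 + 1                                        ≡⟨ cong₂ (λ s t → size R′ + s + t) (sum-indicator a) (sum-indicator b) ⟨
  size R′ + sum (ind a) + sum (ind b)                    ≡⟨ cong (_+ sum (ind b)) (∑-distrib-+ (degree R′) (ind a)) ⟨
  sum (λ x → degree R′ x + ind a x) + sum (ind b)        ≡⟨ ∑-distrib-+ (λ x → degree R′ x + ind a x) (ind b) ⟨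
  sum (λ x → degree R′ x + ind a x + ind b x)            ≡⟨ sum-cong-≗ (degree-remove R R-sym a≢b ab) ⟩
  size R                                                 ∎
  where
  open ≡-Reasoning
  R′ = setEdge R a b false
  ind : Fin N → Fin N → ℕ
  ind p x = χ (does (x ≟ p))

degree-move : ∀ {N} (R : Adj N) {x y z} → Symmetric R → x ≢ y → x ≢ z → y ≢ z → R y z ≡ true → R x z ≡ false →
  ∀ v → degree (setEdge (setEdge R y z false) x z true) v + χ (does (v ≟ y)) ≡ degree R v + χ (does (v ≟ x))
degree-move R {x} {y} {z} R-sym x≢y x≢z y≢z yz xz v = by-cases (v ≟ x) (v ≟ y) (v ≟ z)
  where
  R₁ = setEdge R y z false
  R₂ = setEdge R₁ x z true
  R₁-xz : R₁ x z ≡ false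
  R₁-xz = trans (setEdge-off R y z false x z (joins-miss-fst z x≢y (y≢z ∘ ≡.sym))) xz
  open ≡-Reasoning
  by-cases : Dec (v ≡ x) → Dec (v ≡ y) → Dec (v ≡ z) →
    degree R₂ v + χ (does (v ≟ y)) ≡ degree R v + χ (does (v ≟ x))
  by-cases (yes refl) _ _ = begin
    degree R₂ x + χ (does (x ≟ y)) ≡⟨ cong (degree R₂ x +_) (trans (χ-≟-≢ x≢y) (≡.sym (cong χ R₁-xz))) ⟩
    degree R₂ x + χ (R₁ x z)       ≡⟨ degree-setEdge-fst R₁ x z true x≢z ⟩
    degree R₁ x + 1                ≡⟨ cong₂ _+_ (degree-setEdge-other R y z false x x≢y x≢z) (≡.sym (χ-≟-refl x)) ⟩
    degree R x + χ (does (x ≟ x))  ∎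
  by-cases (no v≢x) (yes refl) _ = begin
    degree R₂ y + χ (does (y ≟ y)) ≡⟨ cong₂ _+_ (degree-setEdge-other R₁ x z true y v≢x y≢z)
                                               (trans (χ-≟-refl y) (≡.sym (cong χ yz))) ⟩
    degree R₁ y + χ (R y z)        ≡⟨ degree-setEdge-fst R y z false y≢z ⟩
    degree R y + 0                 ≡⟨ cong (degree R y +_) (χ-≟-≢ v≢x) ⟨
    degree R y + χ (does (y ≟ x))  ∎
  by-cases (no v≢x) (no v≢y) (yes refl) = begin
    degree R₂ z + χ (does (z ≟ y)) ≡⟨ cong (degree R₂ z +_) (trans (χ-≟-≢ v≢y) (≡.sym (cong χ R₁-zx))) ⟩
    degree R₂ z + χ (R₁ z x)       ≡⟨ degree-setEdge-snd R₁ x z true x≢z ⟩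
    degree R₁ z + 1                ≡⟨ cong (degree R₁ z +_) (cong χ (trans (R-sym z y) yz)) ⟨
    degree R₁ z + χ (R z y)        ≡⟨ degree-setEdge-snd R y z false y≢z ⟩
    degree R z + 0                 ≡⟨ cong (degree R z +_) (χ-≟-≢ v≢x) ⟨
    degree R z + χ (does (z ≟ x))  ∎
    where
    R₁-zx : R₁ z x ≡ false
    R₁-zx = trans (setEdge-off R y z false z x (joins-miss-fst z (y≢z ∘ ≡.sym) x≢y)) (trans (R-sym z x) xz)
  by-cases (no v≢x) (no v≢y) (no v≢z) =
    cong₂ _+_ (trans (degree-setEdge-other R₁ x z true v v≢x v≢z) (degree-setEdge-other R y z false v v≢y v≢z))
              (trans (χ-≟-≢ v≢y) (≡.sym (χ-≟-≢ v≢x)))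

-- Two-switches

switch : ∀ {N} → Adj N → (x y z w : Fin N) → Adj N
switch R x y z w i j =
  if joins x y i j ∨ joins z w i j then false
  else if joins x z i j ∨ joins y w i j then true
  else R i j

record Distinct₄ {N} (x y z w : Fin N) : Set where
  field
    x≢y : x ≢ y
    x≢z : x ≢ z
    x≢w : x ≢ w
    y≢z : y ≢ z
    y≢w : y ≢ w
    z≢w : z ≢ w

module _ {N : ℕ} {x y z w : Fin N} (d : Distinct₄ x y z w) where
  open Distinct₄ d

  Distinct₄-swap : Distinct₄ y x w z
  Distinct₄-swap = record
    { x≢y = x≢y ∘ ≡.sym ; x≢z = y≢w ; x≢w = y≢z ; y≢z = x≢w ; y≢w = x≢z ; z≢w = z≢w ∘ ≡.sym }

  Distinct₄-flip : Distinct₄ z w x y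
  Distinct₄-flip = record
    { x≢y = z≢w ; x≢z = x≢z ∘ ≡.sym ; x≢w = y≢z ∘ ≡.sym ; y≢z = x≢w ∘ ≡.sym ; y≢w = y≢w ∘ ≡.sym ; z≢w = x≢y }

switch-off : ∀ {N} (R : Adj N) x y z w i j →
  joins x y i j ≡ false → joins z w i j ≡ false → joins x z i j ≡ false → joins y w i j ≡ false →
  switch R x y z w i j ≡ R i j
switch-off R x y z w i j xy zw xz yw rewrite xy | zw | xz | yw = refl

switch-swap : ∀ {N} (R : Adj N) x y z w i j → switch R x y z w i j ≡ switch R y x w z i j
switch-swap R x y z w i j =
  cong₂ (λ s t → if s then false else if t then true else R i j)
        (cong₂ _∨_ (joins-comm x y i j) (joins-comm z w i j))
        (∨-comm (joins x z i j) _)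

switch-flip : ∀ {N} (R : Adj N) x y z w i j → switch R x y z w i j ≡ switch R z w x y i j
switch-flip R x y z w i j =
  cong₂ (λ s t → if s then false else if t then true else R i j)
        (∨-comm (joins x y i j) _)
        (cong₂ _∨_ (joins-comm x z i j) (joins-comm y w i j))

switch-sym : ∀ {N} (R : Adj N) x y z w → Symmetric R → Symmetric (switch R x y z w)
switch-sym R x y z w R-sym i j =
  cong₃ (λ s t r → if s then false else if t then true else r)
        (cong₂ _∨_ (joins-sym x y i j) (joins-sym z w i j))
        (cong₂ _∨_ (joins-sym x z i j) (joins-sym y w i j))
        (R-sym i j)
  where
  cong₃ : ∀ {A B C D : Set} (f : A → B → C → D) {a a′ b b′ c c′} → a ≡ a′ → b ≡ b′ → c ≡ c′ → f a b c ≡ f a′ b′ c′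
  cong₃ f refl refl refl = refl

record RowSwitched {N} (S R : Adj N) (v p q : Fin N) : Set where
  field
    removed : S v p ≡ false
    added   : S v q ≡ true
    kept    : ∀ j → j ≢ p → j ≢ q → S v j ≡ R v j

RowSwitched-cong : ∀ {N} {S S′ R : Adj N} {v p q} → (∀ j → S v j ≡ S′ v j) →
  RowSwitched S R v p q → RowSwitched S′ R v p q
RowSwitched-cong eq r = record
  { removed = trans (≡.sym (eq _)) removed
  ; added   = trans (≡.sym (eq _)) added
  ; kept    = λ j j≢p j≢q → trans (≡.sym (eq j)) (kept j j≢p j≢q)
  }
  where open RowSwitched r

module _ {N : ℕ} (R : Adj N) where

  switch-row-fst : ∀ {x y z w} → Distinct₄ x y z w → RowSwitched (switch R x y z w) R x y z
  switch-row-fst {x} {y} {z} {w} d = record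
    { removed = removed
    ; added   = added
    ; kept    = λ j j≢y j≢z → switch-off R x y z w x j
        (joins-miss-snd x x≢y j≢y) (joins-miss-row j x≢z x≢w) (joins-miss-snd x x≢z j≢z) (joins-miss-row j x≢y x≢w)
    }
    where
    open Distinct₄ d
    removed : switch R x y z w x y ≡ false
    removed rewrite joins-ends x y = refl
    added : switch R x y z w x z ≡ true
    added rewrite joins-miss-snd x x≢y (y≢z ∘ ≡.sym) | joins-miss-row z x≢z x≢w | joins-ends x z = refl

  module _ {x y z w : Fin N} (d : Distinct₄ x y z w) where

    switch-row-snd : RowSwitched (switch R x y z w) R y x w
    switch-row-snd = RowSwitched-cong (λ j → ≡.sym (switch-swap R x y z w y j)) (switch-row-fst (Distinct₄-swap d))

    switch-row-thd : RowSwitched (switch R x y z w) R z w x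
    switch-row-thd = RowSwitched-cong (λ j → ≡.sym (switch-flip R x y z w z j)) (switch-row-fst (Distinct₄-flip d))

    switch-row-fth : RowSwitched (switch R x y z w) R w z y
    switch-row-fth = RowSwitched-cong (λ j → ≡.sym (trans (switch-flip R x y z w w j) (switch-swap R z w x y w j)))
                                      (switch-row-fst (Distinct₄-swap (Distinct₄-flip d)))

    switch-keeps : ∀ v j → v ≢ x → v ≢ y → v ≢ z → v ≢ w → switch R x y z w v j ≡ R v j
    switch-keeps v j v≢x v≢y v≢z v≢w = switch-off R x y z w v j
      (joins-miss-row j v≢x v≢y) (joins-miss-row j v≢z v≢w) (joins-miss-row j v≢x v≢z) (joins-miss-row j v≢y v≢w)

degree-row-switched : ∀ {N} {S R : Adj N} {v p q} → RowSwitched S R v p q → p ≢ q →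
  R v p ≡ true → R v q ≡ false → degree S v ≡ degree R v
degree-row-switched r p≢q vp vq = sum-swap _ _ _ _ p≢q (λ j j≢p j≢q → cong χ (kept j j≢p j≢q))
  (cong χ (trans removed (≡.sym vq))) (cong χ (trans added (≡.sym vp)))
  where open RowSwitched r

degree-switch : ∀ {N} (R : Adj N) {x y z w} → Distinct₄ x y z w → Symmetric R →
  R x y ≡ true → R z w ≡ true → R x z ≡ false → R y w ≡ false →
  ∀ v → degree (switch R x y z w) v ≡ degree R v
degree-switch R {x} {y} {z} {w} d R-sym xy zw xz yw v = by-cases (v ≟ x) (v ≟ y) (v ≟ z) (v ≟ w)
  where
  open Distinct₄ d
  by-cases : Dec (v ≡ x) → Dec (v ≡ y) → Dec (v ≡ z) → Dec (v ≡ w) → degree (switch R x y z w) v ≡ degree R v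
  by-cases (yes refl) _ _ _ = degree-row-switched (switch-row-fst R d) y≢z xy xz
  by-cases (no _) (yes refl) _ _ = degree-row-switched (switch-row-snd R d) x≢w (trans (R-sym y x) xy) yw
  by-cases (no _) (no _) (yes refl) _ =
    degree-row-switched (switch-row-thd R d) (x≢w ∘ ≡.sym) zw (trans (R-sym z x) xz)
  by-cases (no _) (no _) (no _) (yes refl) =
    degree-row-switched (switch-row-fth R d) (y≢z ∘ ≡.sym) (trans (R-sym w z) zw) (trans (R-sym w y) yw)
  by-cases (no v≢x) (no v≢y) (no v≢z) (no v≢w) = sum-cong-≗ (λ j → cong χ (switch-keeps R d v j v≢x v≢y v≢z v≢w))

switchᴳ : ∀ {N} (G : Graph N) {x y z w} → Distinct₄ x y z w → Graph N
switchᴳ G {x} {y} {z} {w} d = record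
  { adj    = switch (adj G) x y z w
  ; sym    = switch-sym (adj G) x y z w (Graph.sym G)
  ; irrefl = λ i → trans (switch-off (adj G) x y z w i i
                           (joins-irrefl i x≢y) (joins-irrefl i z≢w) (joins-irrefl i x≢z) (joins-irrefl i y≢w))
                         (Graph.irrefl G i)
  }
  where open Distinct₄ d

switch-keeps-edge : ∀ {N} (R : Adj N) x y z w i j → joins x y i j ≡ false → joins z w i j ≡ false →
  R i j ≡ true → switch R x y z w i j ≡ true
switch-keeps-edge R x y z w i j xy zw ij rewrite xy | zw with joins x z i j ∨ joins y w i j
... | true  = refl
... | false = ij

χ-exchange : ∀ p q → χ p ≤ χ q → χ p + χ (not q) ≤ χ (not p) + χ q
χ-exchange false false _ = s≤s z≤n
χ-exchange false true  _ = z≤n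
χ-exchange true  true  _ = s≤s z≤n

module _ {N : ℕ} {S X : Adj N} (Y : Adj N) {v p q : Fin N} (r : RowSwitched S X v p q) (p≢q : p ≢ q) where
  open RowSwitched r

  private
    switched-entries : χ ((S △ Y) v p) + χ ((S △ Y) v q) ≡ χ (Y v p) + χ (not (Y v q))
    switched-entries = cong₂ (λ s t → χ (s xor Y v p) + χ (t xor Y v q)) removed added

    kept-entries : ∀ j → j ≢ p → j ≢ q → χ ((S △ Y) v j) ≤ χ ((X △ Y) v j)
    kept-entries j j≢p j≢q = ≤-reflexive (cong (λ s → χ (s xor Y v j)) (kept j j≢p j≢q))

  degree-△-row-≤ : χ (Y v p) + χ (not (Y v q)) ≤ χ ((X △ Y) v p) + χ ((X △ Y) v q) →
    degree (S △ Y) v ≤ degree (X △ Y) v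
  degree-△-row-≤ le = sum-mono-≤-at₂ _ _ p q p≢q kept-entries (≤-trans (≤-reflexive switched-entries) le)

  degree-△-row-< : χ (Y v p) + χ (not (Y v q)) < χ ((X △ Y) v p) + χ ((X △ Y) v q) →
    degree (S △ Y) v < degree (X △ Y) v
  degree-△-row-< lt = sum-mono-<-at₂ _ _ p q p≢q kept-entries (≤-<-trans (≤-reflexive switched-entries) lt)

-- Each row of X △ Y touched by the switch weakly shrinks, and row a loses both of its changed entries.
switch-reduces-△ : ∀ {N} (X Y : Adj N) {a b c w} → Distinct₄ a c b w → Symmetric X → Symmetric Y →
  X a c ≡ true → X b w ≡ true → X a b ≡ false → X c w ≡ false →
  Y a b ≡ true → Y a c ≡ false → χ (Y b w) ≤ χ (Y c w) →
  size (switch X a c b w △ Y) < size (X △ Y)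
switch-reduces-△ X Y {a} {b} {c} {w} d X-sym Y-sym ac bw ab cw yab yac ybw≤ycw =
  sum-mono-< a rows row-a
  where
  open Distinct₄ d renaming (x≢y to a≢c; x≢z to a≢b; x≢w to a≢w; y≢z to c≢b; y≢w to c≢w; z≢w to b≢w)
  X′ = switch X a c b w
  row-a : degree (X′ △ Y) a < degree (X △ Y) a
  row-a = degree-△-row-< Y (switch-row-fst X d) c≢b (subst₂ _<_ (≡.sym lhs) (≡.sym rhs) (s≤s z≤n))
    where
    lhs : χ (Y a c) + χ (not (Y a b)) ≡ 0
    lhs rewrite yac | yab = refl
    rhs : χ (X a c xor Y a c) + χ (X a b xor Y a b) ≡ 2
    rhs rewrite ac | ab | yac | yab = refl
  row-c : degree (X′ △ Y) c ≤ degree (X △ Y) c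
  row-c = degree-△-row-≤ Y (switch-row-snd X d) a≢w le
    where
    le : χ (Y c a) + χ (not (Y c w)) ≤ χ (X c a xor Y c a) + χ (X c w xor Y c w)
    le rewrite trans (X-sym c a) ac | trans (Y-sym c a) yac | cw = χ-exchange false (Y c w) z≤n
  row-b : degree (X′ △ Y) b ≤ degree (X △ Y) b
  row-b = degree-△-row-≤ Y (switch-row-thd X d) (a≢w ∘ ≡.sym) le
    where
    le : χ (Y b w) + χ (not (Y b a)) ≤ χ (X b w xor Y b w) + χ (X b a xor Y b a)
    le rewrite bw | trans (X-sym b a) ab | trans (Y-sym b a) yab = χ-exchange (Y b w) true (χ≤1 (Y b w))
  row-w : degree (X′ △ Y) w ≤ degree (X △ Y) w
  row-w = degree-△-row-≤ Y (switch-row-fth X d) (c≢b ∘ ≡.sym) le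
    where
    le : χ (Y w b) + χ (not (Y w c)) ≤ χ (X w b xor Y w b) + χ (X w c xor Y w c)
    le rewrite trans (X-sym w b) bw | trans (X-sym w c) cw =
      χ-exchange (Y w b) (Y w c) (subst₂ (λ s t → χ s ≤ χ t) (Y-sym b w) (Y-sym c w) ybw≤ycw)
  rows : ∀ v → degree (X′ △ Y) v ≤ degree (X △ Y) v
  rows v = by-cases (v ≟ a) (v ≟ c) (v ≟ b) (v ≟ w)
    where
    by-cases : Dec (v ≡ a) → Dec (v ≡ c) → Dec (v ≡ b) → Dec (v ≡ w) → degree (X′ △ Y) v ≤ degree (X △ Y) v
    by-cases (yes refl) _ _ _                     = <⇒≤ row-a
    by-cases (no _) (yes refl) _ _                = row-c
    by-cases (no _) (no _) (yes refl) _           = row-b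
    by-cases (no _) (no _) (no _) (yes refl)      = row-w
    by-cases (no v≢a) (no v≢c) (no v≢b) (no v≢w) =
      ≤-reflexive (sum-cong-≗ (λ j → cong (λ s → χ (s xor Y v j)) (switch-keeps X d v j v≢a v≢c v≢b v≢w)))

-- Aligning two realizations

exchange-neighbour : ∀ {N} (R S : Adj N) a b → degree R a ≡ degree S a → S a b ≡ true → R a b ≡ false →
  ∃[ c ] (c ≢ b × R a c ≡ true × S a c ≡ false)
exchange-neighbour {N} R S a b R≡S ab∈S ab∉R = pick (sum-witness f (λ j → χ (S a j)) ∑S<∑f)
  where
  f : Fin N → ℕ
  f j = χ (R a j) + χ (does (j ≟ b))
  ∑S<∑f : degree S a < sum f
  ∑S<∑f = begin-strict
    degree S a                                 ≡⟨ R≡S ⟨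
    degree R a                                 <⟨ m<m+n (degree R a) z<s ⟩
    degree R a + 1                             ≡⟨ cong (degree R a +_) (sum-indicator b) ⟨
    degree R a + sum (λ j → χ (does (j ≟ b))) ≡⟨ ∑-distrib-+ (λ j → χ (R a j)) _ ⟨
    sum f                                      ∎
    where open ≤-Reasoning
  pick : ∃[ j ] χ (S a j) < f j → ∃[ c ] (c ≢ b × R a c ≡ true × S a c ≡ false)
  pick (j , lt) = decide (j ≟ b)
    where
    decide : Dec (j ≡ b) → ∃[ c ] (c ≢ b × R a c ≡ true × S a c ≡ false)
    decide (yes refl) = contradiction (subst₂ _<_ (cong χ ab∈S) (cong₂ _+_ (cong χ ab∉R) (χ-≟-refl b)) lt) (<-irrefl refl)
    decide (no j≢b) = j , j≢b , proj₂ (χ-< lt′) , proj₁ (χ-< lt′)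
      where
      lt′ : χ (S a j) < χ (R a j)
      lt′ = subst (χ (S a j) <_) (trans (cong (χ (R a j) +_) (χ-≟-≢ j≢b)) (+-identityʳ _)) lt

exchange-cases : ∀ gb gc hb hc → χ hb + χ gc < χ gb + χ hc →
  (gb ≡ true × gc ≡ false × χ hb ≤ χ hc) ⊎ (hc ≡ true × hb ≡ false × χ gc ≤ χ gb)
exchange-cases true  false false _     _ = inj₁ (refl , refl , z≤n)
exchange-cases true  false true  true  _ = inj₁ (refl , refl , ≤-refl)
exchange-cases true  true  false true  _ = inj₂ (refl , refl , ≤-refl)
exchange-cases false false false true  _ = inj₂ (refl , refl , ≤-refl)
exchange-cases true  false true  false (s≤s ())
exchange-cases true  true  false false (s≤s ())
exchange-cases true  true  true  true  (s≤s (s≤s ()))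
exchange-cases true  true  true  false (s≤s ())
exchange-cases false _     true  false ()
exchange-cases false _     false false ()
exchange-cases false true  false true  (s≤s ())
exchange-cases false true  true  true  (s≤s ())
exchange-cases false false true  true  (s≤s ())

χ-split : ∀ g h → (h ≡ true → g ≡ true) → χ (not h ∧ g) + χ h ≡ χ g
χ-split g     false _     = +-identityʳ (χ g)
χ-split true  true  _     = refl
χ-split false true  h⇒g  = contradiction (h⇒g refl) λ ()

module Alignment {N : ℕ} (u : Fin N) (D E : Fin N → ℕ) (D≡E : ∀ v → v ≢ u → D v ≡ E v) where

  record Realizations : Set where
    field
      G H      : Graph N
      isolated : Isolated G u
      degree-G : ∀ v → degree (adj G) v ≡ D v
      degree-H : ∀ v → degree (adj H) v ≡ E v

  Aligned : Realizations → Set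
  Aligned P = ∀ a b → a ≢ u → b ≢ u → adj H a b ≡ true → adj G a b ≡ true
    where open Realizations P

  distance : Realizations → ℕ
  distance P = size (adj G △ adj H)
    where open Realizations P

  module _ (P : Realizations) where
    open Realizations P

    degree-agree : ∀ v → v ≢ u → degree (adj G) v ≡ degree (adj H) v
    degree-agree v v≢u = trans (degree-G v) (trans (D≡E v v≢u) (≡.sym (degree-H v)))

    -- Away from u the degrees agree and H ⊆ G, so the edges of G ∖ H at v are matched by the edge vu of H.
    degree-difference : Aligned P → ∀ v → degree (adj G ∖ adj H) v ≡ χ (adj H v u)
    degree-difference aligned v = by-cases (v ≟ u)
      where
      open ≡-Reasoning
      by-cases : Dec (v ≡ u) → degree (adj G ∖ adj H) v ≡ χ (adj H v u)
      by-cases (yes refl) = begin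
        degree (adj G ∖ adj H) u                 ≡⟨ sum-cong-≗ (λ j → cong (λ g → χ (not (adj H u j) ∧ g)) (isolated j)) ⟩
        sum (λ j → χ (not (adj H u j) ∧ false))  ≡⟨ sum-cong-≗ (λ j → cong χ (∧-zeroʳ (not (adj H u j)))) ⟩
        sum (λ (j : Fin N) → 0)                  ≡⟨ sum-replicate-zero N ⟩
        0                                        ≡⟨ cong χ (Graph.irrefl H u) ⟨
        χ (adj H u u)                            ∎
      by-cases (no v≢u) = +-cancelʳ-≡ (degree (adj H) v) _ _ (begin
        degree (adj G ∖ adj H) v + degree (adj H) v ≡⟨ ∑-distrib-+ (λ j → χ ((adj G ∖ adj H) v j)) _ ⟨
        sum f                                       ≡⟨ +-identityʳ (sum f) ⟨
        sum f + 0                                   ≡⟨ cong (λ g → sum f + χ g) vu∉G ⟨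
        sum f + χ (adj G v u)                       ≡⟨ sum-update f (λ j → χ (adj G v j)) u agree ⟩
        degree (adj G) v + f u                      ≡⟨ cong₂ _+_ (degree-agree v v≢u) f-at-u ⟩
        degree (adj H) v + χ (adj H v u)            ≡⟨ +-comm (degree (adj H) v) _ ⟩
        χ (adj H v u) + degree (adj H) v            ∎)
        where
        f : Fin N → ℕ
        f j = χ ((adj G ∖ adj H) v j) + χ (adj H v j)
        agree : ∀ j → j ≢ u → f j ≡ χ (adj G v j)
        agree j j≢u = χ-split (adj G v j) (adj H v j) (aligned v j v≢u j≢u)
        vu∉G : adj G v u ≡ false
        vu∉G = trans (Graph.sym G v u) (isolated v)
        f-at-u : f u ≡ χ (adj H v u)
        f-at-u = trans (cong (λ g → χ (not (adj H v u) ∧ g) + χ (adj H v u)) vu∉G)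
                       (cong (λ t → χ t + χ (adj H v u)) (∧-zeroʳ _))

    module Exchange {a b c : Fin N} (a≢u : a ≢ u) (b≢u : b ≢ u) (hab : adj H a b ≡ true) (gab : adj G a b ≡ false)
                    (c≢b : c ≢ b) (gac : adj G a c ≡ true) (hac : adj H a c ≡ false) where

      a≢b = adj⇒≢ H hab
      a≢c = adj⇒≢ G gac
      c≢u : c ≢ u
      c≢u = Isolated-≢ G isolated gac

      L R : Fin N → ℕ
      L w = χ (adj G b w) + χ (adj H c w)
      R w = χ (adj H b w) + χ (adj G c w)

      ∑R≡∑L : sum R ≡ sum L
      ∑R≡∑L = begin
        sum R                                ≡⟨ ∑-distrib-+ (λ w → χ (adj H b w)) _ ⟩
        degree (adj H) b + degree (adj G) c  ≡⟨ cong₂ _+_ (≡.sym (degree-agree b b≢u)) (degree-agree c c≢u) ⟩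
        degree (adj G) b + degree (adj H) c  ≡⟨ ∑-distrib-+ (λ w → χ (adj G b w)) _ ⟨
        sum L                                ∎
        where open ≡-Reasoning

      -- Only the entries at a differ: ab ∈ H and ac ∈ G, whereas ba ∉ G and ca ∉ H.
      excess : L a + L b + L c < R a + R b + R c
      excess rewrite trans (Graph.sym G b a) gab | trans (Graph.sym H c a) hac | Graph.irrefl G b | Graph.sym H c b
                   | Graph.irrefl H c | trans (Graph.sym H b a) hab | trans (Graph.sym G c a) gac | Graph.irrefl H b
                   | Graph.sym G c b | Graph.irrefl G c = arith (χ (adj G b c)) (χ (adj H b c))
        where
        arith : ∀ g h → h + (g + 0) < 2 + g + (h + 0)
        arith g h = s≤s (≤-trans (≤-reflexive (+-comm-0 g h)) (n≤1+n _))
          where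
          +-comm-0 : ∀ g h → h + (g + 0) ≡ g + (h + 0)
          +-comm-0 = solve-∀

      switch-in-G : ∀ {w} → Distinct₄ a c b w → adj G b w ≡ true → adj G c w ≡ false →
        χ (adj H b w) ≤ χ (adj H c w) → Σ Realizations λ P′ → distance P′ < distance P
      switch-in-G {w} d gbw gcw hbw≤hcw = P′ , switch-reduces-△ (adj G) (adj H) d (Graph.sym G) (Graph.sym H)
                                                            gac gbw gab gcw hab hac hbw≤hcw
        where
        P′ : Realizations
        P′ = record P
          { G        = switchᴳ G d
          ; isolated = λ j → trans (switch-keeps (adj G) d u j (a≢u ∘ ≡.sym) (c≢u ∘ ≡.sym) (b≢u ∘ ≡.sym)
                                                     (Isolated-≢ G isolated gbw ∘ ≡.sym))
                                   (isolated j)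
          ; degree-G = λ v → trans (degree-switch (adj G) d (Graph.sym G) gac gbw gab gcw v) (degree-G v)
          }

      switch-in-H : ∀ {w} → Distinct₄ a b c w → adj H c w ≡ true → adj H b w ≡ false →
        χ (adj G c w) ≤ χ (adj G b w) → Σ Realizations λ P′ → distance P′ < distance P
      switch-in-H {w} d hcw hbw gcw≤gbw = P′ , (begin-strict
          size (adj G △ switch (adj H) a b c w) ≡⟨ size-△-comm (adj G) _ ⟩
          size (switch (adj H) a b c w △ adj G) <⟨ switch-reduces-△ (adj H) (adj G) d (Graph.sym H) (Graph.sym G)
                                                                     hab hcw hac hbw gac gab gcw≤gbw ⟩
          size (adj H △ adj G)                 ≡⟨ size-△-comm (adj H) _ ⟩
          size (adj G △ adj H)                 ∎)
        where
        open ≤-Reasoning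
        P′ : Realizations
        P′ = record P
          { H        = switchᴳ H d
          ; degree-H = λ v → trans (degree-switch (adj H) d (Graph.sym H) hab hcw hac hbw v) (degree-H v)
          }

      improvement : Σ Realizations λ P′ → distance P′ < distance P
      improvement with sum-witness-outside₃ L R a b c a≢b a≢c (c≢b ∘ ≡.sym) (≤-reflexive ∑R≡∑L) excess
      ... | w , w≢a , w≢b , w≢c , Rw<Lw
          with exchange-cases (adj G b w) (adj G c w) (adj H b w) (adj H c w) Rw<Lw
      ... | inj₁ (gbw , gcw , hbw≤hcw) = switch-in-G d gbw gcw hbw≤hcw
        where
        d : Distinct₄ a c b w
        d = record { x≢y = a≢c ; x≢z = a≢b ; x≢w = w≢a ∘ ≡.sym ; y≢z = c≢b ; y≢w = w≢c ∘ ≡.sym ; z≢w = w≢b ∘ ≡.sym }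
      ... | inj₂ (hcw , hbw , gcw≤gbw) = switch-in-H d hcw hbw gcw≤gbw
        where
        d : Distinct₄ a b c w
        d = record { x≢y = a≢b ; x≢z = a≢c ; x≢w = w≢a ∘ ≡.sym ; y≢z = c≢b ∘ ≡.sym ; y≢w = w≢b ∘ ≡.sym ; z≢w = w≢c ∘ ≡.sym }

  align-step : ∀ P → Aligned P ⊎ Σ Realizations (λ P′ → distance P′ < distance P)
  align-step P
    with any? (λ a → any? (λ b → ¬? (a ≟ u) ×-dec ¬? (b ≟ u) ×-dec adj H a b ≟ᵇ true ×-dec adj G a b ≟ᵇ false))
    where open Realizations P
  ... | yes (a , b , a≢u , b≢u , hab , gab) =
    let c , c≢b , gac , hac = exchange-neighbour (adj G) (adj H) a b (degree-agree P a a≢u) hab gab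
    in inj₂ (Exchange.improvement P a≢u b≢u hab gab c≢b gac hac)
    where open Realizations P
  ... | no none = inj₁ λ a b a≢u b≢u hab → ¬-not (λ gab → none (a , b , a≢u , b≢u , hab , gab))

  align : Realizations → Σ Realizations Aligned
  align = descend distance align-step

-- Moving the matching onto the top vertices

module Shift {N : ℕ} (u : Fin N) (δ : ℕ) (δ≤N : δ ≤ N) (top≢u : ∀ v → toℕ v < δ → v ≢ u)
             (D : Fin N → ℕ) (mono : ∀ x y → toℕ x < δ → δ ≤ toℕ y → y ≢ u → D y ≤ D x) where

  record Matched : Set where
    field
      G M        : Graph N
      isolated   : Isolated G u
      degree-G   : ∀ v → degree (adj G) v ≡ D v
      M⊆G        : ∀ i j → adj M i j ≡ true → adj G i j ≡ true
      degree-M≤1 : ∀ v → degree (adj M) v ≤ 1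
      size-M     : size (adj M) ≡ δ

  top : Fin N → Bool
  top v = toℕ v <ᵇ δ

  CoversTop : Matched → Set
  CoversTop S = ∀ v → toℕ v < δ → degree (adj M) v ≡ 1
    where open Matched S

  deficit : Adj N → Fin N → ℕ
  deficit R v = if top v then 1 ∸ degree R v else 0

  uncovered : Matched → ℕ
  uncovered S = sum (deficit (adj (Matched.M S)))

  module Move (S : Matched) {x : Fin N} (x<δ : toℕ x < δ) (x-free : degree (adj (Matched.M S)) x ≡ 0) where
    open Matched S

    x∉M : ∀ j → adj M x j ≡ false
    x∉M = degree-zero (adj M) x x-free

    -- Counting: the δ units of M-degree cannot all sit on the δ top vertices, since x has none.
    covered-low : ∃[ y ] (δ ≤ toℕ y × degree (adj M) y ≡ 1)
    covered-low with sum-witness f (λ v → χ (top v)) ∑top<∑f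
      where
      f : Fin N → ℕ
      f v = degree (adj M) v + χ (does (v ≟ x))
      ∑top<∑f : sum (λ v → χ (top v)) < sum f
      ∑top<∑f = begin-strict
        sum (λ v → χ (top v))                ≡⟨ sum-initial-segment N δ δ≤N ⟩
        δ                                    <⟨ m<m+n δ z<s ⟩
        δ + 1                                ≡⟨ cong₂ _+_ size-M (sum-indicator x) ⟨
        size (adj M) + sum (λ v → χ (does (v ≟ x))) ≡⟨ ∑-distrib-+ (degree (adj M)) _ ⟨
        sum f                                ∎
        where open ≤-Reasoning
    ... | y , lt = decide (y ≟ x)
      where
      decide : Dec (y ≡ x) → ∃[ y ] (δ ≤ toℕ y × degree (adj M) y ≡ 1)
      decide (yes refl) = contradiction (subst₂ _<_ (cong χ (<⇒<ᵇ≡true x<δ)) (cong₂ _+_ x-free (χ-≟-refl x)) lt) (<-irrefl refl)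
      decide (no y≢x) = y , <ᵇ≡false⇒≥ (proj₁ (χ-< (subst (χ (top y) <_) deg-y lt′))) , deg-y
        where
        lt′ : χ (top y) < degree (adj M) y
        lt′ = subst (χ (top y) <_) (trans (cong (degree (adj M) y +_) (χ-≟-≢ y≢x)) (+-identityʳ _)) lt
        deg-y : degree (adj M) y ≡ 1
        deg-y = ≤-antisym (degree-M≤1 y) (≤-trans (s≤s z≤n) lt′)

    module Retarget {y z : Fin N} (δ≤y : δ ≤ toℕ y) (yz∈M : adj M y z ≡ true) where

      y≢z = adj⇒≢ M yz∈M
      x≢y : x ≢ y
      x≢y refl = <⇒≱ x<δ δ≤y
      x≢z : x ≢ z
      x≢z refl = contradiction (trans (≡.sym yz∈M) (trans (Graph.sym M y x) (x∉M y))) λ ()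

      M′ : Graph N
      M′ = setEdgeᴳ (setEdgeᴳ M y z y≢z false) x z x≢z true

      shifted : ∀ v → degree (adj M′) v + χ (does (v ≟ y)) ≡ degree (adj M) v + χ (does (v ≟ x))
      shifted = degree-move (adj M) (Graph.sym M) x≢y x≢z y≢z yz∈M (x∉M z)

      degree-M′-x : degree (adj M′) x ≡ 1
      degree-M′-x = +-cancelʳ-≡ 0 _ _ (begin
        degree (adj M′) x + 0              ≡⟨ cong (degree (adj M′) x +_) (χ-≟-≢ x≢y) ⟨
        degree (adj M′) x + χ (does (x ≟ y)) ≡⟨ shifted x ⟩
        degree (adj M) x + χ (does (x ≟ x))  ≡⟨ cong₂ _+_ x-free (χ-≟-refl x) ⟩
        1 + 0                              ∎)
        where open ≡-Reasoning

      degree-M′-other : ∀ v → v ≢ x → v ≢ y → degree (adj M′) v ≡ degree (adj M) v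
      degree-M′-other v v≢x v≢y = +-cancelʳ-≡ 0 _ _
        (trans (cong (degree (adj M′) v +_) (≡.sym (χ-≟-≢ v≢y))) (trans (shifted v) (cong (degree (adj M) v +_) (χ-≟-≢ v≢x))))

      size-M′ : size (adj M′) ≡ δ
      size-M′ = +-cancelʳ-≡ 1 _ _ (begin
        size (adj M′) + 1                                     ≡⟨ cong (size (adj M′) +_) (sum-indicator y) ⟨
        size (adj M′) + sum (λ v → χ (does (v ≟ y)))          ≡⟨ ∑-distrib-+ (degree (adj M′)) _ ⟨
        sum (λ v → degree (adj M′) v + χ (does (v ≟ y)))      ≡⟨ sum-cong-≗ shifted ⟩
        sum (λ v → degree (adj M) v + χ (does (v ≟ x)))       ≡⟨ ∑-distrib-+ (degree (adj M)) _ ⟩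
        size (adj M) + sum (λ v → χ (does (v ≟ x)))           ≡⟨ cong₂ _+_ size-M (sum-indicator x) ⟩
        δ + 1                                                 ∎)
        where open ≡-Reasoning

      degree-M′≤1 : ∀ v → degree (adj M′) v ≤ 1
      degree-M′≤1 v = ≤-trans (m≤m+n _ _) (subst (_≤ 1) (≡.sym (shifted v)) (bound (v ≟ x)))
        where
        bound : Dec (v ≡ x) → degree (adj M) v + χ (does (v ≟ x)) ≤ 1
        bound (yes refl) = ≤-reflexive (cong₂ _+_ x-free (χ-≟-refl x))
        bound (no v≢x)   = subst (_≤ 1) (≡.sym (trans (cong (degree (adj M) v +_) (χ-≟-≢ v≢x)) (+-identityʳ _)))
                                 (degree-M≤1 v)

      uncovered-M′ : sum (deficit (adj M′)) < sum (deficit (adj M))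
      uncovered-M′ = sum-mono-< x pointwise at-x
        where
        at-x : deficit (adj M′) x < deficit (adj M) x
        at-x rewrite <⇒<ᵇ≡true x<δ | degree-M′-x | x-free = s≤s z≤n
        pointwise : ∀ v → deficit (adj M′) v ≤ deficit (adj M) v
        pointwise v = by-cases (v ≟ x) (v ≟ y)
          where
          by-cases : Dec (v ≡ x) → Dec (v ≡ y) → deficit (adj M′) v ≤ deficit (adj M) v
          by-cases (yes refl) _      = <⇒≤ at-x
          by-cases (no _) (yes refl) rewrite ≤⇒<ᵇ≡false δ≤y = z≤n
          by-cases (no v≢x) (no v≢y) = ≤-reflexive (cong (λ d → if top v then 1 ∸ d else 0) (degree-M′-other v v≢x v≢y))

      M′-edges : ∀ i j → adj M′ i j ≡ true → joins x z i j ≡ true ⊎ (joins y z i j ≡ false × adj M i j ≡ true)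
      M′-edges i j e with joins x z i j
      ... | true  = inj₁ refl
      ... | false with joins y z i j
      ...   | true  = contradiction e λ ()
      ...   | false = inj₂ (refl , e)

      M′⊆ : (G′ : Graph N) → adj G′ x z ≡ true →
        (∀ i j → joins y z i j ≡ false → adj M i j ≡ true → adj G′ i j ≡ true) →
        ∀ i j → adj M′ i j ≡ true → adj G′ i j ≡ true
      M′⊆ G′ xz∈G′ keep i j e with M′-edges i j e
      ... | inj₂ (¬yz , ij∈M) = keep i j ¬yz ij∈M
      ... | inj₁ xz with joins-true {a = x} {z} {i} {j} xz
      ...   | inj₁ (refl , refl) = xz∈G′
      ...   | inj₂ (refl , refl) = trans (Graph.sym G′ z x) xz∈G′

      retarget : (G′ : Graph N) → Isolated G′ u → (∀ v → degree (adj G′) v ≡ D v) →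
        (∀ i j → adj M′ i j ≡ true → adj G′ i j ≡ true) → Σ Matched λ S′ → uncovered S′ < uncovered S
      retarget G′ iso deg sub = record
        { G = G′ ; M = M′ ; isolated = iso ; degree-G = deg ; M⊆G = sub ; degree-M≤1 = degree-M′≤1 ; size-M = size-M′ }
        , uncovered-M′

      yz∈G : adj G y z ≡ true
      yz∈G = M⊆G y z yz∈M

      via-switch : adj G x z ≡ false → Σ Matched λ S′ → uncovered S′ < uncovered S
      via-switch xz∉G
        with sum-witness-outside₃ (λ j → χ (adj G x j)) (λ j → χ (adj G y j)) x y z x≢y x≢z y≢z ∑y≤∑x excess
        where
        ∑y≤∑x : degree (adj G) y ≤ degree (adj G) x
        ∑y≤∑x = subst₂ _≤_ (≡.sym (degree-G y)) (≡.sym (degree-G x))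
                       (mono x y x<δ δ≤y (Isolated-≢ G isolated (trans (Graph.sym G z y) yz∈G)))
        excess : χ (adj G x x) + χ (adj G x y) + χ (adj G x z) < χ (adj G y x) + χ (adj G y y) + χ (adj G y z)
        excess rewrite Graph.irrefl G x | xz∉G | Graph.sym G y x | Graph.irrefl G y | yz∈G = m<m+n _ z<s
      ... | w , w≢x , w≢y , w≢z , lt =
        retarget G′ isolated′ degree-G′ (M′⊆ G′ (RowSwitched.added (switch-row-fst (adj G) d)) keep)
        where
        yw∉G = proj₁ (χ-< lt)
        xw∈G = proj₂ (χ-< lt)
        d : Distinct₄ x w z y
        d = record { x≢y = w≢x ∘ ≡.sym ; x≢z = x≢z ; x≢w = x≢y ; y≢z = w≢z ; y≢w = w≢y ; z≢w = y≢z ∘ ≡.sym }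
        G′ = switchᴳ G d
        isolated′ : Isolated G′ u
        isolated′ j = trans (switch-keeps (adj G) d u j (top≢u x x<δ ∘ ≡.sym) (w≢u ∘ ≡.sym) (z≢u ∘ ≡.sym) (y≢u ∘ ≡.sym))
                            (isolated j)
          where
          w≢u = Isolated-≢ G isolated xw∈G
          z≢u = Isolated-≢ G isolated yz∈G
          y≢u = Isolated-≢ G isolated (trans (Graph.sym G z y) yz∈G)
        degree-G′ : ∀ v → degree (adj G′) v ≡ D v
        degree-G′ v = trans (degree-switch (adj G) d (Graph.sym G) xw∈G (trans (Graph.sym G z y) yz∈G) xz∉G
                                           (trans (Graph.sym G w y) yw∉G) v)
                            (degree-G v)
        -- The removed edge xw is not in M because x is unmatched; zy is the edge M gives up.
        keep : ∀ i j → joins y z i j ≡ false → adj M i j ≡ true → adj G′ i j ≡ true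
        keep i j ¬yz ij∈M = switch-keeps-edge (adj G) x w z y i j ¬xw (trans (joins-comm z y i j) ¬yz) (M⊆G i j ij∈M)
          where
          ¬xw : joins x w i j ≡ false
          ¬xw = ¬-not λ xw → case (joins-true {a = x} {w} {i} {j} xw)
            where
            case : (i ≡ x × j ≡ w) ⊎ (i ≡ w × j ≡ x) → ⊥
            case (inj₁ (refl , refl)) = contradiction (trans (≡.sym ij∈M) (x∉M w)) λ ()
            case (inj₂ (refl , refl)) = contradiction (trans (≡.sym ij∈M) (trans (Graph.sym M w x) (x∉M w))) λ ()

      result : Σ Matched λ S′ → uncovered S′ < uncovered S
      result with adj G x z in xz
      ... | true  = retarget G isolated degree-G (M′⊆ G xz (λ i j _ → M⊆G i j))
      ... | false = via-switch xz

    improvement : Σ Matched λ S′ → uncovered S′ < uncovered S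
    improvement =
      let y , δ≤y , deg-y = covered-low
          z , yz∈M        = degree-pos (adj M) y (subst (0 <_) (≡.sym deg-y) z<s)
      in Retarget.result δ≤y yz∈M

  shift-step : ∀ S → CoversTop S ⊎ Σ Matched (λ S′ → uncovered S′ < uncovered S)
  shift-step S with any? (λ x → toℕ x <? δ ×-dec degree (adj (Matched.M S)) x ≟ℕ 0)
  ... | yes (x , x<δ , x-free) = inj₂ (Move.improvement S x<δ x-free)
  ... | no none = inj₁ λ v v<δ → [ (λ deg≡0 → contradiction (v , v<δ , deg≡0) none) , id ]′
                                  (n≤1⇒n≡0∨n≡1 (Matched.degree-M≤1 S v))

  shift : Matched → Σ Matched CoversTop
  shift = descend uncovered shift-step

-- Matchings

Matching-⊆ : ∀ {N} {G G′ : Graph N} {k} → (∀ i j → adj G i j ≡ true → adj G′ i j ≡ true) → Matching G k → Matching G′ k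
Matching-⊆ G⊆G′ 𝓜 = record
  { edge = edge 𝓜 ; isEdge = λ p → G⊆G′ _ _ (isEdge 𝓜 p) ; disjoint = disjoint 𝓜 }

free-avoids : ∀ {N} (G : Graph N) {v c d} → degree (adj G) v ≡ 0 → adj G c d ≡ true → c ≢ v × d ≢ v
free-avoids G {v} {c} {d} free cd =
  (λ { refl → contradiction (trans (≡.sym cd) (degree-zero (adj G) v free d)) λ () }) ,
  (λ { refl → contradiction (trans (≡.sym (trans (Graph.sym G d c) cd)) (degree-zero (adj G) v free c)) λ () })

Matching-cons : ∀ {N} {M M′ : Graph N} {k v w} → adj M v w ≡ true → (∀ i j → adj M′ i j ≡ true → adj M i j ≡ true) →
  (𝓜′ : Matching M′ k) → (∀ q → DisjointPair (edge 𝓜′ q) (v , w)) → Matching M (suc k)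
Matching-cons {N} {M} {k = k} {v} {w} vw∈M M′⊆M 𝓜′ avoid = record { edge = edges ; isEdge = isEdges ; disjoint = disjoints }
  where
  edges : Fin (suc k) → Fin N × Fin N
  edges zero    = v , w
  edges (suc p) = edge 𝓜′ p
  isEdges : ∀ p → Edge M (edges p)
  isEdges zero    = vw∈M
  isEdges (suc p) = M′⊆M _ _ (isEdge 𝓜′ p)
  disjoints : ∀ p q → p ≢ q → DisjointPair (edges p) (edges q)
  disjoints zero    zero    p≢q = contradiction refl p≢q
  disjoints zero    (suc q) _   = let c≢v , c≢w , d≢v , d≢w = avoid q
                                  in c≢v ∘ ≡.sym , d≢v ∘ ≡.sym , c≢w ∘ ≡.sym , d≢w ∘ ≡.sym
  disjoints (suc p) zero    _   = avoid p
  disjoints (suc p) (suc q) p≢q = disjoint 𝓜′ p q (p≢q ∘ cong suc)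

matching-of-degree≤1 : ∀ {N} k (M : Graph N) → (∀ v → degree (adj M) v ≤ 1) → size (adj M) ≡ k + k →
  Σ (Matching M k) λ 𝓜 → ∀ v → degree (adj M) v ≡ 1 → Covers 𝓜 v
matching-of-degree≤1 zero M _ size≡0 =
  record { edge = λ () ; isEdge = λ () ; disjoint = λ () } ,
  λ v deg≡1 → contradiction (≤-trans (≤-reflexive (≡.sym deg≡1)) (≤-trans (≤-sum (degree (adj M)) v) (≤-reflexive size≡0)))
                            λ ()
matching-of-degree≤1 {N} (suc k) M ≤1 size≡
  with sum-witness (degree (adj M)) (λ _ → 0) (subst₂ _<_ (≡.sym (sum-replicate-zero N)) (≡.sym size≡) z<s)
... | v , pos with degree-pos (adj M) v pos
... | w , vw∈M = 𝓜 , covers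
  where
  v≢w = adj⇒≢ M vw∈M
  M′ = setEdgeᴳ M v w v≢w false
  removed : ∀ x → degree (adj M′) x + χ (does (x ≟ v)) + χ (does (x ≟ w)) ≡ degree (adj M) x
  removed = degree-remove (adj M) (Graph.sym M) v≢w vw∈M
  drop : ∀ x → χ (does (x ≟ v)) + χ (does (x ≟ w)) ≡ 1 → degree (adj M′) x ≡ 0
  drop x one = n≤0⇒n≡0 (+-cancelʳ-≤ 1 _ 0 (begin
    degree (adj M′) x + 1                                         ≡⟨ cong (degree (adj M′) x +_) one ⟨
    degree (adj M′) x + (χ (does (x ≟ v)) + χ (does (x ≟ w)))     ≡⟨ +-assoc (degree (adj M′) x) _ _ ⟨
    degree (adj M′) x + χ (does (x ≟ v)) + χ (does (x ≟ w))       ≡⟨ removed x ⟩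
    degree (adj M) x                                              ≤⟨ ≤1 x ⟩
    1                                                             ∎))
    where open ≤-Reasoning
  size-M′ : size (adj M′) ≡ k + k
  size-M′ = +-cancelʳ-≡ 2 _ _ (trans (size-remove (adj M) (Graph.sym M) v≢w vw∈M) (trans size≡ (rearrange k)))
    where
    rearrange : ∀ k → suc k + suc k ≡ k + k + 2
    rearrange = solve-∀
  IH = matching-of-degree≤1 k M′ (λ x → ≤-trans (≤-trans (m≤m+n _ _) (m≤m+n _ _)) (≤-trans (≤-reflexive (removed x)) (≤1 x)))
                              size-M′
  𝓜′ = proj₁ IH
  avoids : ∀ q → DisjointPair (edge 𝓜′ q) (v , w)
  avoids q =
    let c≢v , d≢v = free-avoids M′ (drop v (cong₂ _+_ (χ-≟-refl v) (χ-≟-≢ v≢w))) (isEdge 𝓜′ q)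
        c≢w , d≢w = free-avoids M′ (drop w (cong₂ _+_ (χ-≟-≢ (v≢w ∘ ≡.sym)) (χ-≟-refl w))) (isEdge 𝓜′ q)
    in c≢v , c≢w , d≢v , d≢w
  𝓜 : Matching M (suc k)
  𝓜 = Matching-cons vw∈M (setEdge-false-⊆ (adj M) v w) 𝓜′ avoids
  covers : ∀ x → degree (adj M) x ≡ 1 → Covers 𝓜 x
  covers x deg≡1 = by-cases (x ≟ v) (x ≟ w)
    where
    by-cases : Dec (x ≡ v) → Dec (x ≡ w) → Covers 𝓜 x
    by-cases (yes refl) _      = zero , inj₁ refl
    by-cases (no _) (yes refl) = zero , inj₂ refl
    by-cases (no x≢v) (no x≢w) =
      let p , ends = proj₂ IH x (begin
            degree (adj M′) x                                         ≡⟨ trans (+-identityʳ _) (+-identityʳ _) ⟨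
            degree (adj M′) x + 0 + 0                                 ≡⟨ cong₂ (λ s t → degree (adj M′) x + s + t) (χ-≟-≢ x≢v) (χ-≟-≢ x≢w) ⟨
            degree (adj M′) x + χ (does (x ≟ v)) + χ (does (x ≟ w))   ≡⟨ removed x ⟩
            degree (adj M) x                                          ≡⟨ deg≡1 ⟩
            1                                                         ∎)
      in suc p , ends
      where open ≡-Reasoning

RaisesAt : ∀ {N} → Fin N → ℕ → Graph N → Graph N → Set
RaisesAt u m R R′ = (∀ v → v ≢ u → degree (adj R′) v ≡ degree (adj R) v) × degree (adj R′) u ≡ degree (adj R) u + m

absorb-edge : ∀ {N} (R : Graph N) {u a b} → u ≢ a → u ≢ b → adj R a b ≡ true → adj R u a ≡ false → adj R u b ≡ false →
  Σ (Graph N) λ R′ → RaisesAt u 2 R R′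
    × (∀ i j → joins a b i j ≡ false → joins u a i j ≡ false → joins u b i j ≡ false → adj R′ i j ≡ adj R i j)
absorb-edge R {u} {a} {b} u≢a u≢b ab ua ub = R₂ , (same , grow) , off
  where
  a≢b = adj⇒≢ R ab
  R₁ = setEdgeᴳ (setEdgeᴳ R a b a≢b false) u b u≢b true
  R₂ = setEdgeᴳ R₁ u a u≢a true
  moved : ∀ v → degree (adj R₁) v + χ (does (v ≟ a)) ≡ degree (adj R) v + χ (does (v ≟ u))
  moved = degree-move (adj R) (Graph.sym R) u≢a u≢b a≢b ab ub
  R₁-ua : adj R₁ u a ≡ false
  R₁-ua = trans (setEdge-off (setEdge (adj R) a b false) u b true u a (joins-miss-snd u u≢b (a≢b)))
                (trans (setEdge-off (adj R) a b false u a (joins-miss-row a u≢a u≢b)) ua)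
  same : ∀ v → v ≢ u → degree (adj R₂) v ≡ degree (adj R) v
  same v v≢u = by-cases (v ≟ a)
    where
    open ≡-Reasoning
    by-cases : Dec (v ≡ a) → degree (adj R₂) v ≡ degree (adj R) v
    by-cases (yes refl) = begin
      degree (adj R₂) a                       ≡⟨ +-identityʳ _ ⟨
      degree (adj R₂) a + 0                   ≡⟨ cong (λ t → degree (adj R₂) a + χ t) (trans (Graph.sym R₁ a u) R₁-ua) ⟨
      degree (adj R₂) a + χ (adj R₁ a u)      ≡⟨ degree-setEdge-snd (adj R₁) u a true u≢a ⟩
      degree (adj R₁) a + 1                   ≡⟨ cong (degree (adj R₁) a +_) (χ-≟-refl a) ⟨
      degree (adj R₁) a + χ (does (a ≟ a))    ≡⟨ moved a ⟩
      degree (adj R) a + χ (does (a ≟ u))     ≡⟨ cong (degree (adj R) a +_) (χ-≟-≢ v≢u) ⟩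
      degree (adj R) a + 0                    ≡⟨ +-identityʳ _ ⟩
      degree (adj R) a                        ∎
    by-cases (no v≢a) = trans (degree-setEdge-other (adj R₁) u a true v v≢u v≢a)
                              (+-cancelʳ-≡ 0 _ _ (trans (cong (degree (adj R₁) v +_) (≡.sym (χ-≟-≢ v≢a)))
                                                 (trans (moved v) (cong (degree (adj R) v +_) (χ-≟-≢ v≢u)))))
  grow : degree (adj R₂) u ≡ degree (adj R) u + 2
  grow = begin
    degree (adj R₂) u                       ≡⟨ +-identityʳ _ ⟨
    degree (adj R₂) u + 0                   ≡⟨ cong (λ t → degree (adj R₂) u + χ t) R₁-ua ⟨
    degree (adj R₂) u + χ (adj R₁ u a)      ≡⟨ degree-setEdge-fst (adj R₁) u a true u≢a ⟩
    degree (adj R₁) u + 1                   ≡⟨ cong (λ t → t + 1) (+-identityʳ _) ⟨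
    degree (adj R₁) u + 0 + 1               ≡⟨ cong (λ t → degree (adj R₁) u + t + 1) (χ-≟-≢ u≢a) ⟨
    degree (adj R₁) u + χ (does (u ≟ a)) + 1 ≡⟨ cong (_+ 1) (moved u) ⟩
    degree (adj R) u + χ (does (u ≟ u)) + 1 ≡⟨ cong (λ t → degree (adj R) u + t + 1) (χ-≟-refl u) ⟩
    degree (adj R) u + 1 + 1                ≡⟨ +-assoc (degree (adj R) u) 1 1 ⟩
    degree (adj R) u + 2                    ∎
    where open ≡-Reasoning
  off : ∀ i j → joins a b i j ≡ false → joins u a i j ≡ false → joins u b i j ≡ false → adj R₂ i j ≡ adj R i j
  off i j ab′ ua′ ub′ = trans (setEdge-off (adj R₁) u a true i j ua′)
                              (trans (setEdge-off (setEdge (adj R) a b false) u b true i j ub′)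
                                     (setEdge-off (adj R) a b false i j ab′))

absorb-matching : ∀ {N} (u : Fin N) k (R : Graph N) (𝓜 : Matching R k) →
  (∀ p → proj₁ (edge 𝓜 p) ≢ u × proj₂ (edge 𝓜 p) ≢ u) →
  (∀ p → adj R u (proj₁ (edge 𝓜 p)) ≡ false × adj R u (proj₂ (edge 𝓜 p)) ≡ false) →
  Σ (Graph N) (RaisesAt u (k + k) R)
absorb-matching u zero    R 𝓜 _   _   = R , (λ _ _ → refl) , ≡.sym (+-identityʳ _)
absorb-matching {N} u (suc k) R 𝓜 ≢u ∉N =
  continue (absorb-edge R u≢a u≢b (isEdge 𝓜 zero) (proj₁ (∉N zero)) (proj₂ (∉N zero)))
  where
  a = proj₁ (edge 𝓜 zero)
  b = proj₂ (edge 𝓜 zero)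
  u≢a = proj₁ (≢u zero) ∘ ≡.sym
  u≢b = proj₂ (≢u zero) ∘ ≡.sym
  continue : Σ (Graph N) (λ R₂ → RaisesAt u 2 R R₂
               × (∀ i j → joins a b i j ≡ false → joins u a i j ≡ false → joins u b i j ≡ false → adj R₂ i j ≡ adj R i j)) →
    Σ (Graph N) (RaisesAt u (suc k + suc k) R)
  continue (R₂ , (same , grow) , off) =
    let R′ , same′ , grow′ = absorb-matching u k R₂ 𝓜′ (≢u ∘ suc) ∉N′
    in R′ , (λ v v≢u → trans (same′ v v≢u) (same v v≢u)) , (begin
         degree (adj R′) u                      ≡⟨ grow′ ⟩
         degree (adj R₂) u + (k + k)            ≡⟨ cong (_+ (k + k)) grow ⟩
         degree (adj R) u + 2 + (k + k)         ≡⟨ rearrange (degree (adj R) u) k ⟩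
         degree (adj R) u + (suc k + suc k)     ∎)
    where
    open ≡-Reasoning
    rearrange : ∀ d k → d + 2 + (k + k) ≡ d + (suc k + suc k)
    rearrange = solve-∀
    -- The remaining edges avoid a and b, so the exchange left them (and their non-adjacency to u) untouched.
    avoids : ∀ p → let (c , d) = edge 𝓜 (suc p) in c ≢ a × c ≢ b × d ≢ a × d ≢ b
    avoids p = disjoint 𝓜 (suc p) zero λ ()
    𝓜′ : Matching R₂ k
    𝓜′ = record
      { edge     = edge 𝓜 ∘ suc
      ; isEdge   = λ p → let c≢a , c≢b , _ = avoids p ; c≢u , _ = ≢u (suc p) ; d = proj₂ (edge 𝓜 (suc p)) in
          trans (off _ _ (joins-miss-row d c≢a c≢b) (joins-miss-row d c≢u c≢a) (joins-miss-row d c≢u c≢b)) (isEdge 𝓜 (suc p))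
      ; disjoint = λ p q p≢q → disjoint 𝓜 (suc p) (suc q) (p≢q ∘ suc-injective)
      }
    ∉N′ : ∀ p → adj R₂ u (proj₁ (edge 𝓜 (suc p))) ≡ false × adj R₂ u (proj₂ (edge 𝓜 (suc p))) ≡ false
    ∉N′ p = let c≢a , c≢b , d≢a , d≢b = avoids p ; c∉N , d∉N = ∉N (suc p) ; c , d = edge 𝓜 (suc p) in
      trans (off u _ (joins-miss-row c u≢a u≢b) (joins-miss-snd u u≢a c≢a) (joins-miss-snd u u≢b c≢b)) c∉N ,
      trans (off u _ (joins-miss-row d u≢a u≢b) (joins-miss-snd u u≢a d≢a) (joins-miss-snd u u≢b d≢b)) d∉N

-- The last vertex

liftᵛ : ∀ {n} → Adj n → {x y : Fin (suc n)} → TopView x → TopView y → Bool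
liftᵛ A (‵inject₁ i) (‵inject₁ j) = A i j
liftᵛ A _            _            = false

lift : ∀ {n} → Adj n → Adj (suc n)
lift A x y = liftᵛ A (view x) (view y)

lift-inject₁ : ∀ {n} (A : Adj n) i j → lift A (inject₁ i) (inject₁ j) ≡ A i j
lift-inject₁ A i j rewrite view-inject₁ i | view-inject₁ j = refl

lift-last : ∀ {n} (A : Adj n) x → lift A (fromℕ n) x ≡ false
lift-last {n} A x rewrite view-fromℕ n = refl

lift-last′ : ∀ {n} (A : Adj n) x → lift A x (fromℕ n) ≡ false
lift-last′ {n} A x rewrite view-fromℕ n with view x
... | ‵fromℕ      = refl
... | ‵inject₁ _  = refl

liftᴳ : ∀ {n} → Graph n → Graph (suc n)
liftᴳ G = record { adj = lift (adj G) ; sym = λ x y → sym-v (view x) (view y) ; irrefl = λ x → irrefl-v (view x) }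
  where
  sym-v : ∀ {x y} (vx : TopView x) (vy : TopView y) → liftᵛ (adj G) vx vy ≡ liftᵛ (adj G) vy vx
  sym-v (‵inject₁ i) (‵inject₁ j) = Graph.sym G i j
  sym-v (‵inject₁ i) ‵fromℕ       = refl
  sym-v ‵fromℕ       (‵inject₁ j) = refl
  sym-v ‵fromℕ       ‵fromℕ       = refl
  irrefl-v : ∀ {x} (vx : TopView x) → liftᵛ (adj G) vx vx ≡ false
  irrefl-v (‵inject₁ i) = Graph.irrefl G i
  irrefl-v ‵fromℕ       = refl

restrict : ∀ {n} → Graph (suc n) → Graph n
restrict G = record
  { adj = λ i j → adj G (inject₁ i) (inject₁ j) ; sym = λ i j → Graph.sym G _ _ ; irrefl = λ i → Graph.irrefl G _ }

degree-inject₁ : ∀ {n} (R : Adj (suc n)) i → R (inject₁ i) (fromℕ n) ≡ false →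
  degree R (inject₁ i) ≡ degree (λ a b → R (inject₁ a) (inject₁ b)) i
degree-inject₁ R i last∉R = trans (sum-init-last (λ j → χ (R (inject₁ i) j)))
                                 (trans (cong (λ t → degree (λ a b → R (inject₁ a) (inject₁ b)) i + χ t) last∉R) (+-identityʳ _))

size-restrict : ∀ {n} (G : Graph (suc n)) → (∀ x → adj G x (fromℕ n) ≡ false) → size (adj (restrict G)) ≡ size (adj G)
size-restrict {n} G last∉G = begin
  size (adj (restrict G))                                  ≡⟨ sum-cong-≗ (λ i → degree-inject₁ (adj G) i (last∉G _)) ⟨
  sum (λ i → degree (adj G) (inject₁ i))                   ≡⟨ +-identityʳ _ ⟨
  sum (λ i → degree (adj G) (inject₁ i)) + 0               ≡⟨ cong (sum (λ i → degree (adj G) (inject₁ i)) +_) last-free ⟨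
  sum (λ i → degree (adj G) (inject₁ i)) + degree (adj G) (fromℕ n) ≡⟨ sum-init-last (degree (adj G)) ⟨
  size (adj G)                                             ∎
  where
  open ≡-Reasoning
  last-free : degree (adj G) (fromℕ n) ≡ 0
  last-free = trans (sum-cong-≗ (λ j → cong χ (trans (Graph.sym G _ j) (last∉G j)))) (sum-replicate-zero (suc n))

degree-lift : ∀ {n} (A : Adj n) i → degree (lift A) (inject₁ i) ≡ degree A i
degree-lift A i = trans (degree-inject₁ (lift A) i (lift-last′ A (inject₁ i))) (sum-cong-≗ (λ j → cong χ (lift-inject₁ A i j)))

degree-lift-last : ∀ {n} (A : Adj n) → degree (lift A) (fromℕ n) ≡ 0
degree-lift-last {n} A = trans (sum-cong-≗ (λ j → cong χ (lift-last A j))) (sum-replicate-zero (suc n))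

lookup-∷ʳ-inject₁ : ∀ {n} (d : Vec ℕ n) δ i → lookup (d ∷ʳ δ) (inject₁ i) ≡ lookup d i
lookup-∷ʳ-inject₁ (x ∷ d) δ zero    = refl
lookup-∷ʳ-inject₁ (x ∷ d) δ (suc i) = lookup-∷ʳ-inject₁ d δ i

lookup-∷ʳ-last : ∀ {n} (d : Vec ℕ n) δ → lookup (d ∷ʳ δ) (fromℕ n) ≡ δ
lookup-∷ʳ-last []      δ = refl
lookup-∷ʳ-last (x ∷ d) δ = lookup-∷ʳ-last d δ

liftᴹ : ∀ {n} {G : Graph n} {k} → Matching G k → Matching (liftᴳ G) k
liftᴹ {G = G} 𝓜 = record
  { edge     = λ p → inject₁ (proj₁ (edge 𝓜 p)) , inject₁ (proj₂ (edge 𝓜 p))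
  ; isEdge   = λ p → trans (lift-inject₁ (adj G) _ _) (isEdge 𝓜 p)
  ; disjoint = λ p q p≢q → let ac , ad , bc , bd = disjoint 𝓜 p q p≢q in
      ac ∘ inject₁-injective , ad ∘ inject₁-injective , bc ∘ inject₁-injective , bd ∘ inject₁-injective
  }

backward : ∀ {n} (d : Vec ℕ n) k (G : Graph n) → Realizes G d → Matching G k → Graphic (d ∷ʳ (k + k))
backward {n} d k G G-realizes 𝓜 = R′ , λ v → trans (deg≡degree R′ v) (realizes (view v))
  where
  u = fromℕ n
  absorbed = absorb-matching u k (liftᴳ G) (liftᴹ 𝓜)
               (λ p → (fromℕ≢inject₁ ∘ ≡.sym) , (fromℕ≢inject₁ ∘ ≡.sym)) (λ p → lift-last (adj G) _ , lift-last (adj G) _)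
  R′ = proj₁ absorbed
  realizes : ∀ {v} → TopView v → degree (adj R′) v ≡ lookup (d ∷ʳ (k + k)) v
  realizes (‵inject₁ i) = begin
    degree (adj R′) (inject₁ i)          ≡⟨ proj₁ (proj₂ absorbed) (inject₁ i) (fromℕ≢inject₁ ∘ ≡.sym) ⟩
    degree (lift (adj G)) (inject₁ i)    ≡⟨ degree-lift (adj G) i ⟩
    degree (adj G) i                     ≡⟨ deg≡degree G i ⟨
    deg G i                              ≡⟨ G-realizes i ⟩
    lookup d i                           ≡⟨ lookup-∷ʳ-inject₁ d (k + k) i ⟨
    lookup (d ∷ʳ (k + k)) (inject₁ i)    ∎
    where open ≡-Reasoning
  realizes ‵fromℕ = begin
    degree (adj R′) u                    ≡⟨ proj₂ (proj₂ absorbed) ⟩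
    degree (lift (adj G)) u + (k + k)    ≡⟨ cong (_+ (k + k)) (degree-lift-last (adj G)) ⟩
    k + k                                ≡⟨ lookup-∷ʳ-last d (k + k) ⟨
    lookup (d ∷ʳ (k + k)) u              ∎
    where open ≡-Reasoning

module Forward {n : ℕ} (d : Vec ℕ n) (δ : ℕ) (δ≤n : δ ≤ n) (nonincreasing : NonIncreasing d) where

  u : Fin (suc n)
  u = fromℕ n

  D E : Fin (suc n) → ℕ
  D = lookup (d ∷ʳ 0)
  E = lookup (d ∷ʳ δ)

  D≡E : ∀ v → v ≢ u → D v ≡ E v
  D≡E v v≢u = on-view (view v) v≢u
    where
    on-view : ∀ {v} → TopView v → v ≢ u → D v ≡ E v
    on-view (‵inject₁ i) _   = trans (lookup-∷ʳ-inject₁ d 0 i) (≡.sym (lookup-∷ʳ-inject₁ d δ i))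
    on-view ‵fromℕ       u≢u = contradiction refl u≢u

  top≢u : ∀ v → toℕ v < δ → v ≢ u
  top≢u v v<δ refl = <⇒≱ v<δ (≤-trans δ≤n (≤-reflexive (≡.sym (toℕ-fromℕ n))))

  mono : ∀ x y → toℕ x < δ → δ ≤ toℕ y → y ≢ u → D y ≤ D x
  mono x y x<δ δ≤y y≢u = on-views (view x) (view y) x<δ δ≤y y≢u
    where
    on-views : ∀ {x y} → TopView x → TopView y → toℕ x < δ → δ ≤ toℕ y → y ≢ u → D y ≤ D x
    on-views ‵fromℕ       _            x<δ _   _   = contradiction refl (top≢u _ x<δ)
    on-views (‵inject₁ i) ‵fromℕ       _   _   u≢u = contradiction refl u≢u
    on-views (‵inject₁ i) (‵inject₁ j) x<δ δ≤y _   =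
      subst₂ _≤_ (≡.sym (lookup-∷ʳ-inject₁ d 0 j)) (≡.sym (lookup-∷ʳ-inject₁ d 0 i))
             (nonincreasing i j (<⇒≤ (<-≤-trans (subst (_< δ) (toℕ-inject₁ i) x<δ) (subst (δ ≤_) (toℕ-inject₁ j) δ≤y))))

  open Alignment u D E D≡E public
  open Shift u δ (≤-trans δ≤n (n≤1+n n)) top≢u D mono public

  initial : Graphic d → Graphic (d ∷ʳ δ) → Realizations
  initial (G₀ , G₀-realizes) (H₀ , H₀-realizes) = record
    { G        = liftᴳ G₀
    ; H        = H₀
    ; isolated = lift-last (adj G₀)
    ; degree-G = λ v → degree-G (view v)
    ; degree-H = λ v → trans (≡.sym (deg≡degree H₀ v)) (H₀-realizes v)
    }
    where
    degree-G : ∀ {v} → TopView v → degree (lift (adj G₀)) v ≡ D v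
    degree-G (‵inject₁ i) = trans (degree-lift (adj G₀) i)
                              (trans (≡.sym (deg≡degree G₀ i)) (trans (G₀-realizes i) (≡.sym (lookup-∷ʳ-inject₁ d 0 i))))
    degree-G ‵fromℕ       = trans (degree-lift-last (adj G₀)) (≡.sym (lookup-∷ʳ-last d 0))

  matched : (P : Realizations) → Aligned P → Matched
  matched P aligned = record
    { G          = G
    ; M          = G ∖ᴳ H
    ; isolated   = isolated
    ; degree-G   = degree-G
    ; M⊆G        = λ i j → ∧-true-right (not (adj H i j))
    ; degree-M≤1 = λ v → subst (_≤ 1) (≡.sym (degree-difference P aligned v)) (χ≤1 _)
    ; size-M     = begin
        size (adj G ∖ adj H)        ≡⟨ sum-cong-≗ (degree-difference P aligned) ⟩
        sum (λ v → χ (adj H v u))   ≡⟨ sum-cong-≗ (λ v → cong χ (Graph.sym H v u)) ⟩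
        degree (adj H) u            ≡⟨ degree-H u ⟩
        E u                         ≡⟨ lookup-∷ʳ-last d δ ⟩
        δ                           ∎
    }
    where
    open Realizations P
    open ≡-Reasoning
    ∧-true-right : ∀ a {b} → a ∧ b ≡ true → b ≡ true
    ∧-true-right true e = e

  restricted : (S : Matched) → CoversTop S → ∀ k → δ ≡ k + k →
    Σ (Graph n) λ G → Realizes G d × Σ (Matching G k) λ 𝓜 → ∀ v → toℕ v < δ → Covers 𝓜 v
  restricted S covers k δ≡k+k = restrict G , realizes , Matching-⊆ (λ i j → M⊆G _ _) 𝓜 , covers-top
    where
    open Matched S
    G-last : ∀ x → adj G x u ≡ false
    G-last x = trans (Graph.sym G x u) (isolated x)
    M-last : ∀ x → adj M x u ≡ false
    M-last x = ¬-not λ xu∈M → contradiction (trans (≡.sym (M⊆G x u xu∈M)) (G-last x)) λ ()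
    degree-restrict-M : ∀ i → degree (adj (restrict M)) i ≡ degree (adj M) (inject₁ i)
    degree-restrict-M i = ≡.sym (degree-inject₁ (adj M) i (M-last _))
    realizes : Realizes (restrict G) d
    realizes i = begin
      deg (restrict G) i               ≡⟨ deg≡degree (restrict G) i ⟩
      degree (adj (restrict G)) i      ≡⟨ degree-inject₁ (adj G) i (G-last _) ⟨
      degree (adj G) (inject₁ i)       ≡⟨ degree-G (inject₁ i) ⟩
      lookup (d ∷ʳ 0) (inject₁ i)      ≡⟨ lookup-∷ʳ-inject₁ d 0 i ⟩
      lookup d i                       ∎
      where open ≡-Reasoning
    size-restrict-M : size (adj (restrict M)) ≡ k + k
    size-restrict-M = trans (size-restrict M M-last) (trans size-M δ≡k+k)
    extracted = matching-of-degree≤1 k (restrict M) (λ i → subst (_≤ 1) (≡.sym (degree-restrict-M i)) (degree-M≤1 _))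
                                     size-restrict-M
    𝓜 = proj₁ extracted
    covers-top : ∀ v → toℕ v < δ → Covers 𝓜 v
    covers-top v v<δ =
      proj₂ extracted v (trans (degree-restrict-M v) (covers (inject₁ v) (subst (_< δ) (≡.sym (toℕ-inject₁ v)) v<δ)))

forward : ∀ {n} (d : Vec ℕ n) δ → Graphic d → NonIncreasing d → δ ≤ n → ∀ k → δ ≡ k + k → Graphic (d ∷ʳ δ) →
  Σ (Graph n) λ G → Realizes G d × Σ (Matching G k) λ 𝓜 → ∀ v → toℕ v < δ → Covers 𝓜 v
forward d δ graphic nonincreasing δ≤n k δ≡k+k graphic′ =
  let P , aligned = align (initial graphic graphic′)
      S , covers  = shift (matched P aligned)
  in restricted S covers k δ≡k+k
  where open Forward d δ δ≤n nonincreasing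

half+half : ∀ δ → δ % 2 ≡ 0 → δ ≡ δ / 2 + δ / 2
half+half δ even = begin
  δ                  ≡⟨ m/n*n≡m (m%n≡0⇒n∣m δ 2 even) ⟨
  δ / 2 * 2          ≡⟨ *-comm (δ / 2) 2 ⟩
  δ / 2 + (δ / 2 + 0) ≡⟨ cong (δ / 2 +_) (+-identityʳ (δ / 2)) ⟩
  δ / 2 + δ / 2      ∎
  where open ≡-Reasoning

theorem2p9 : ∀ {n} (d : Vec ℕ n) (δ : ℕ) →
    Graphic d → NonIncreasing d →
    0 < δ → δ % 2 ≡ 0 → δ ≤ n →
    Graphic (d ∷ʳ δ) ⇔
      (Σ (Graph n) λ G → Realizes G d ×
        Σ (Matching G (δ / 2)) λ M → ∀ v → toℕ v < δ → Covers M v)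
theorem2p9 d δ graphic nonincreasing _ even δ≤n = mk⇔
  (forward d δ graphic nonincreasing δ≤n (δ / 2) (half+half δ even))
  (λ (G , realizes , 𝓜 , _) → subst (λ m → Graphic (d ∷ʳ m)) (≡.sym (half+half δ even)) (backward d (δ / 2) G realizes 𝓜))
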